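{- Let $\mathbb{F}$ be a field with $\operatorname{char}(\mathbb{F})\neq 2$. Then $\mathbf{VNP}_1^{\mathrm{weak}}\subsetneq\mathbf{VNP}_1^{\mathrm{weak}+}=\mathbf{VNP}$.
   Context: A width-1 algebraic branching program computes a product of its edge labels. Let $\mathbb{S}$ be the set of affine linear forms $\alpha x_i+\beta$ ($\alpha,\beta\in\mathbb{F}$), and $\mathbb{S}^+=\{\alpha x_i+\beta x_j+\gamma\mid\alpha,\beta,\gamma\in\mathbb{F}\}$ the affine linear forms in at most two variables. $\mathbf{VP}_1^{\mathrm{weak}}$ (resp. $\mathbf{VP}_1^{\mathrm{weak}+}$) is the class of families (in polynomially many variables) $(f_n)$ such that $f_n$ is a product of polynomially many forms from $\mathbb{S}$ (resp. $\mathbb{S}^+$). For a class $\mathbf{C}$, $\mathrm{N}(\mathbf{C})$ consists of families $(f_n)$ for which there are $(g_n)\in\mathbf{C}$ and polynomially bounded $p,q$ with $f_n(\mathbf{x})=\sum_{\mathbf{b}\in\{0,1\}^{p(n)}}g_{q(n)}(\mathbf{b},\mathbf{x})$; $\mathbf{VNP}_1^{\mathrm{weak}}=\mathrm{N}(\mathbf{VP}_1^{\mathrm{weak}})$ and $\mathbf{VNP}_1^{\mathrm{weak}+}=\mathrm{N}(\mathbf{VP}_1^{\mathrm{weak}+})$. $\mathbf{VNP}$ is Valiant's class of p-definable families, equal to $\mathrm{N}(\mathbf{VP}_e)$ with $\mathbf{VP}_e$ the families of polynomially bounded arithmetic formula size. -}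

module Defs where

open import Level using (Level; _⊔_)
open import Algebra.Bundles using (CommutativeRing)
open import Data.Nat as ℕ using (ℕ; zero; suc; _≤_; _<_; _^_; _∸_; _≡ᵇ_)
open import Data.Bool using (Bool; true; false; if_then_else_; _∧_)
open import Data.List using (List; []; _∷_; map; foldr; length; concatMap; upTo)
open import Data.List.Relation.Unary.All using (All)
open import Data.Product using (Σ; ∃; _×_; _,_)
open import Relation.Nullary using (¬_)
open import Data.Unit using (⊤)

record Field (c ℓ : Level) : Set (Level.suc (c ⊔ ℓ)) where
  field
    commutativeRing : CommutativeRing c ℓ
  open CommutativeRing commutativeRing public
  field
    1≉0     : ¬ (1# ≈ 0#)
    inverse : ∀ x → ¬ (x ≈ 0#) → ∃ λ y → x * y ≈ 1#

PolyBounded : (ℕ → ℕ) → Set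
PolyBounded p = ∃ λ c → ∀ n → p n ≤ c ℕ.+ n ^ c

data Expr {c} (A : Set c) : Set c where
  var  : ℕ → Expr A
  con  : A → Expr A
  _⊕_  : Expr A → Expr A → Expr A
  _⊗_  : Expr A → Expr A → Expr A

size : ∀ {c} {A : Set c} → Expr A → ℕ
size (var _)  = 1
size (con _)  = 1
size (e ⊕ f)  = suc (size e ℕ.+ size f)
size (e ⊗ f)  = suc (size e ℕ.+ size f)

VarsBelow : ∀ {c} {A : Set c} → ℕ → Expr A → Set
VarsBelow k (var i) = i < k
VarsBelow k (con _) = ⊤
VarsBelow k (e ⊕ f) = VarsBelow k e × VarsBelow k f
VarsBelow k (e ⊗ f) = VarsBelow k e × VarsBelow k f

subst : ∀ {c} {A : Set c} → (ℕ → Expr A) → Expr A → Expr A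
subst σ (var i) = σ i
subst σ (con a) = con a
subst σ (e ⊕ f) = subst σ e ⊕ subst σ f
subst σ (e ⊗ f) = subst σ e ⊗ subst σ f

-- Monomials: exponent vectors (x₀^{m₀} x₁^{m₁} …), trailing entries 0.

Monomial : Set
Monomial = List ℕ

isZeroMon : Monomial → Bool
isZeroMon []      = true
isZeroMon (k ∷ m) = (k ≡ᵇ 0) ∧ isZeroMon m

isUnitMon : ℕ → Monomial → Bool
isUnitMon _       []            = false
isUnitMon zero    (1 ∷ m)       = isZeroMon m
isUnitMon zero    (_ ∷ m)       = false
isUnitMon (suc i) (zero ∷ m)    = isUnitMon i m
isUnitMon (suc i) (suc _ ∷ m)   = false

splits : Monomial → List (Monomial × Monomial)
splits []      = ([] , []) ∷ []
splits (k ∷ m) =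
  concatMap (λ a → map (λ { (r₁ , r₂) → (a ∷ r₁ , (k ∸ a) ∷ r₂) }) (splits m))
            (upTo (suc k))

module Poly {c ℓ} (F : Field c ℓ) where
  open Field F

  E : Set c
  E = Expr Carrier

  coeff : E → Monomial → Carrier
  coeff (var i) m = if isUnitMon i m then 1# else 0#
  coeff (con a) m = if isZeroMon m then a else 0#
  coeff (e ⊕ f) m = coeff e m + coeff f m
  coeff (e ⊗ f) m =
    foldr (λ { (m₁ , m₂) acc → coeff e m₁ * coeff f m₂ + acc }) 0# (splits m)

  _≈ₚ_ : E → E → Set ℓ
  e ≈ₚ f = ∀ m → coeff e m ≈ coeff f m

  Family : Set c
  Family = ℕ → E

  Class : Set (Level.suc (c ⊔ ℓ))
  Class = Family → Set (c ⊔ ℓ)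

  _⊆_ : Class → Class → Set (c ⊔ ℓ)
  C ⊆ D = ∀ f → C f → D f

  prod : List E → E
  prod = foldr _⊗_ (con 1#)

  sum : List E → E
  sum = foldr _⊕_ (con 0#)

  formS : Carrier × Carrier × ℕ → E
  formS (α , β , i) = (con α ⊗ var i) ⊕ con β

  formS⁺ : Carrier × Carrier × Carrier × ℕ × ℕ → E
  formS⁺ (α , β , γ , i , j) = ((con α ⊗ var i) ⊕ (con β ⊗ var j)) ⊕ con γ

  VP1weak : Class
  VP1weak f = ∃ λ p → PolyBounded p × ∀ n →
    Σ (List (Carrier × Carrier × ℕ)) λ L →
      length L ≤ p n ×
      All (λ { (_ , _ , i) → i < p n }) L ×
      f n ≈ₚ prod (map formS L)

  VP1weak+ : Class
  VP1weak+ f = ∃ λ p → PolyBounded p × ∀ n →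
    Σ (List (Carrier × Carrier × Carrier × ℕ × ℕ)) λ L →
      length L ≤ p n ×
      All (λ { (_ , _ , _ , i , j) → i < p n × j < p n }) L ×
      f n ≈ₚ prod (map formS⁺ L)

  VPe : Class
  VPe f = ∃ λ s → PolyBounded s × ∀ n →
    Σ E λ e → size e ≤ s n × VarsBelow (s n) e × f n ≈ₚ e

  allBits : ℕ → List (List Bool)
  allBits zero    = [] ∷ []
  allBits (suc k) = concatMap (λ bs → (false ∷ bs) ∷ (true ∷ bs) ∷ []) (allBits k)

  bit : Bool → Carrier
  bit true  = 1#
  bit false = 0#

  -- substitution (b, x): variables x₀…x_{k-1} of g get the bits b,
  -- variable x_{k+j} of g becomes x_j
  plug : List Bool → ℕ → E
  plug []       i       = var i
  plug (b ∷ bs) zero    = con (bit b)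
  plug (b ∷ bs) (suc i) = plug bs i

  hsum : ℕ → E → E
  hsum k g = sum (map (λ b → subst (plug b) g) (allBits k))

  N : Class → Class
  N C f = Σ Family λ g → C g × ∃ λ p → ∃ λ q → PolyBounded p × PolyBounded q ×
    ∀ n → f n ≈ₚ hsum (p n) (g (q n))

  VNP1weak : Class
  VNP1weak = N VP1weak

  VNP1weak+ : Class
  VNP1weak+ = N VP1weak+

  VNP : Class
  VNP = N VPe

{-# OPTIONS --safe #-}

-- VNP ⊆ VNP₁^weak+: a formula e is turned into a product of two-variable forms containing extra bits
-- that are summed out. A control bit t is attached to each gate, whose part of the sum must be the
-- value of the gate if t = 1 and 1 if t = 0. A product gate passes t on to both factors; a variable
-- and a sum gate need one and three extra bits, and division by 2.
--
-- VNP₁^weak ≠ VNP₁^weak+: as no form contains both a summed bit and a free variable, a hypercube sum of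
-- a product of univariate forms is again a scalar multiple of such a product, so its values at
-- x₀, x₁ ∈ {0, 1} form a singular 2 × 2 matrix. Those of x₀ + x₁ do not.
--
-- Both need that ≈ₚ is a congruence: the coefficient functions form a commutative ring under
-- convolution, and equal coefficients stay equal after substituting field elements for variables.
module Submission where

open import Defs
open import Algebra.Bundles using (CommutativeRing)
open import Algebra.Solver.Ring.AlmostCommutativeRing using (fromCommutativeRing; _-Raw-AlmostCommutative⟶_)
open import Data.Bool.Base using (Bool; true; false; if_then_else_)
open import Data.Integer.Base as ℤ using (ℤ; -[1+_]; _⊖_)
import Data.Integer.Properties as ℤₚ
open import Data.List.Base using (List; []; _∷_; _++_; map; foldr; concatMap; applyUpTo; upTo; length)
open import Data.List.Properties using (length-map)
open import Data.List.Relation.Unary.All as All using (All; []; _∷_)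
import Data.List.Relation.Unary.All.Properties as Allₚ
open import Data.Maybe.Base using (Maybe; just; nothing)
open import Data.Nat.Base as ℕ using (ℕ; zero; suc; _∸_; _≤_; _<_; _^_; z≤n; s≤s)
import Data.Nat.Properties as ℕₚ
open import Data.Nat.Tactic.RingSolver using (solve-∀)
open import Data.Product.Base using (_×_; _,_; proj₁; proj₂; ∃-syntax)
open import Data.Unit.Base using (tt)
open import Function.Base using (_∘_; id)
open import Level using (_⊔_)
import Relation.Binary.PropositionalEquality as ≡
open ≡ using (_≡_; _≗_)
open import Relation.Nullary using (¬_; yes; no)

-- A gate is a weight on a few bits, and an affine form in two bits has too few coefficients to
-- prescribe its values at all four corners. So one factor vanishes at the forbidden corner, and a
-- second one interpolates the quotients at the other three. For `varGate` the weights at (t, s) =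
-- (0, 0), (1, 0), (0, 1), (1, 1) should be -1, 1, 1, 0. As 2 - t - s is 2, 1, 1 at the first three,
-- the other factor must be -1/2, 1, 1 there, which is (3t + 3s - 1)/2: hence 1/2 and the
-- coefficients `h + h + h`. In `sumGate` the same method gives (v, t) = (0, 0), (0, 1), (1, 1) the
-- weights 1/2, -2, 1/2. At u = w = 0 the remaining three factors multiply to 2 if v = 0 and to 8 if
-- v = 1, so t = 0 leaves 1 and t = 1 leaves -4 + 4 = 0. A gate that is switched off yields 1 and
-- not 0, because the summand that a sum gate does not select must leave the rest of the product
-- unchanged.

-- Polynomially bounded functions.

module PolynomialBounds where
  open import Data.Nat.Base using (_+_; _*_)
  open ℕₚ.≤-Reasoning

  -- Equivalent to PolyBounded, and closed under the operations with simple exponents.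
  Dominated : (ℕ → ℕ) → Set
  Dominated p = ∃[ c ] ∀ n → p n ≤ (2 + n) ^ c

  n≤2^n : ∀ n → n ≤ 2 ^ n
  n≤2^n zero    = z≤n
  n≤2^n (suc n) = begin
    1 + n               ≤⟨ ℕₚ.+-mono-≤ (ℕₚ.m^n>0 2 n) (n≤2^n n) ⟩
    2 ^ n + 2 ^ n       ≡⟨ ≡.cong (2 ^ n +_) (ℕₚ.+-identityʳ _) ⟨
    2 ^ suc n           ∎

  n≤[2+m]^n : ∀ m n → n ≤ (2 + m) ^ n
  n≤[2+m]^n m n = ℕₚ.≤-trans (n≤2^n n) (ℕₚ.^-monoˡ-≤ n (ℕₚ.m≤m+n 2 m))

  dominated-mono : ∀ {p q} → (∀ n → p n ≤ q n) → Dominated q → Dominated p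
  dominated-mono p≤q (c , q≤) = c , λ n → ℕₚ.≤-trans (p≤q n) (q≤ n)

  dominated-const : ∀ k → Dominated (λ _ → k)
  dominated-const k = k , λ n → n≤[2+m]^n n k

  -- The base `2 + n` is at least 2, so one further factor absorbs the doubling.
  dominated-+ : ∀ {p q} → Dominated p → Dominated q → Dominated (λ n → p n + q n)
  dominated-+ {p} {q} (c , p≤) (d , q≤) = suc (c + d) , λ n → begin
    p n + q n                               ≤⟨ ℕₚ.+-mono-≤ (p≤ n) (q≤ n) ⟩
    (2 + n) ^ c + (2 + n) ^ d               ≤⟨ ℕₚ.+-mono-≤ (ℕₚ.^-monoʳ-≤ (2 + n) (ℕₚ.m≤m+n c d)) (ℕₚ.^-monoʳ-≤ (2 + n) (ℕₚ.m≤n+m d c)) ⟩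
    (2 + n) ^ (c + d) + (2 + n) ^ (c + d)   ≤⟨ ℕₚ.+-monoʳ-≤ ((2 + n) ^ (c + d)) (ℕₚ.m≤m+n _ (n * (2 + n) ^ (c + d))) ⟩
    (2 + n) ^ suc (c + d)                   ∎

  dominated-* : ∀ {p q} → Dominated p → Dominated q → Dominated (λ n → p n * q n)
  dominated-* {p} {q} (c , p≤) (d , q≤) = c + d , λ n → begin
    p n * q n                     ≤⟨ ℕₚ.*-mono-≤ (p≤ n) (q≤ n) ⟩
    (2 + n) ^ c * (2 + n) ^ d     ≡⟨ ℕₚ.^-distribˡ-+-* (2 + n) c d ⟨
    (2 + n) ^ (c + d)             ∎

  dominated-∘ : ∀ {p q} → Dominated p → Dominated q → Dominated (p ∘ q)
  dominated-∘ {p} {q} (c , p≤) q-dominated with dominated-+ (dominated-const 2) q-dominated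
  ... | d , 2+q≤ = d * c , λ n → begin
    p (q n)                 ≤⟨ p≤ (q n) ⟩
    (2 + q n) ^ c           ≤⟨ ℕₚ.^-monoˡ-≤ c (2+q≤ n) ⟩
    ((2 + n) ^ d) ^ c       ≡⟨ ℕₚ.^-*-assoc (2 + n) d c ⟩
    (2 + n) ^ (d * c)       ∎

  polyBounded⇒dominated : ∀ {p} → PolyBounded p → Dominated p
  polyBounded⇒dominated (c , p≤) = dominated-mono p≤
    (dominated-+ (dominated-const c) (c , λ n → ℕₚ.^-monoˡ-≤ c (ℕₚ.m≤n+m n 2)))

  dominated⇒polyBounded : ∀ {p} → Dominated p → PolyBounded p
  dominated⇒polyBounded {p} (c , p≤) = C , λ n → ℕₚ.≤-trans (p≤ n) (bound n)
    where
    -- The summand `3 ^ c` covers n = 0 and n = 1, where powers of n do not grow; the exponent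
    -- `2 * c` covers n ≥ 2, where 2 + n ≤ n².
    C = 3 ^ c + 2 * c
    bound : ∀ n → (2 + n) ^ c ≤ C + n ^ C
    bound 0 = ℕₚ.m≤n⇒m≤n+o _ (ℕₚ.m≤n⇒m≤n+o (2 * c) (ℕₚ.^-monoˡ-≤ c (s≤s (s≤s z≤n))))
    bound 1 = ℕₚ.m≤n⇒m≤n+o _ (ℕₚ.m≤m+n (3 ^ c) (2 * c))
    bound n@(suc (suc m)) = ℕₚ.m≤n⇒m≤o+n C (begin
      (2 + n) ^ c     ≤⟨ ℕₚ.^-monoˡ-≤ c 2+n≤n² ⟩
      (n ^ 2) ^ c     ≡⟨ ℕₚ.^-*-assoc n 2 c ⟩
      n ^ (2 * c)     ≤⟨ ℕₚ.^-monoʳ-≤ n (ℕₚ.m≤n+m (2 * c) (3 ^ c)) ⟩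
      n ^ C           ∎)
      where
      2+n≤n² : 2 + n ≤ n ^ 2
      2+n≤n² = begin
        2 + n                 ≤⟨ ℕₚ.+-monoˡ-≤ n (s≤s (s≤s z≤n)) ⟩
        n + n                 ≤⟨ ℕₚ.+-monoʳ-≤ n (ℕₚ.m≤m+n n (m * n)) ⟩
        n * n                 ≡⟨ ≡.cong (n *_) (ℕₚ.*-identityʳ n) ⟨
        n ^ 2                 ∎

  polyBounded-affine : ∀ a b {p} → PolyBounded p → PolyBounded (λ n → a * p n + b)
  polyBounded-affine a b bd = dominated⇒polyBounded
    (dominated-+ (dominated-* (dominated-const a) (polyBounded⇒dominated bd)) (dominated-const b))

open PolynomialBounds

-- A ring solver with integer coefficients over any commutative ring.

module IntegerSolver {c ℓ} (R : CommutativeRing c ℓ) where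
  open import Data.Integer.Base using (+_)
  open CommutativeRing R
  open import Algebra.Properties.Ring ring
    using (-0#≈0#; -‿involutive; -‿distribˡ-*; -‿distribʳ-*)
  open import Algebra.Properties.AbelianGroup +-abelianGroup using (⁻¹-∙-comm)
  open import Algebra.Properties.Semiring.Mult.TCOptimised semiring
    using (1+×; ×-homo-+; ×1-homo-*) renaming (_×_ to _·_)
  open import Algebra.Properties.CommutativeSemigroup +-commutativeSemigroup using (interchange)
  open import Relation.Binary.Reasoning.Setoid setoid

  fromℤ : ℤ → Carrier
  fromℤ (+ n)    = n · 1#
  fromℤ -[1+ n ] = - (suc n · 1#)

  fromℤ-⊖ : ∀ m n → fromℤ (m ⊖ n) ≈ m · 1# - n · 1#
  fromℤ-⊖ m zero = sym (trans (+-congˡ -0#≈0#) (+-identityʳ _))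
  fromℤ-⊖ zero (suc n) = sym (+-identityˡ _)
  fromℤ-⊖ (suc m) (suc n) = begin
    fromℤ (suc m ⊖ suc n)               ≡⟨ ≡.cong fromℤ (ℤₚ.[1+m]⊖[1+n]≡m⊖n m n) ⟩
    fromℤ (m ⊖ n)                       ≈⟨ fromℤ-⊖ m n ⟩
    m · 1# - n · 1#                     ≈⟨ +-identityˡ _ ⟨
    0# + (m · 1# - n · 1#)              ≈⟨ +-congʳ (-‿inverseʳ 1#) ⟨
    (1# - 1#) + (m · 1# - n · 1#)       ≈⟨ interchange 1# (- 1#) (m · 1#) (- (n · 1#)) ⟩
    (1# + m · 1#) + (- 1# - n · 1#)     ≈⟨ +-congˡ (⁻¹-∙-comm 1# (n · 1#)) ⟩
    (1# + m · 1#) - (1# + n · 1#)       ≈⟨ +-cong (1+× m 1#) (-‿cong (1+× n 1#)) ⟨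
    suc m · 1# - suc n · 1#             ∎

  fromℤ-+ : ∀ i j → fromℤ (i ℤ.+ j) ≈ fromℤ i + fromℤ j
  fromℤ-+ (+ m) (+ n) = ×-homo-+ 1# m n
  fromℤ-+ (+ m) -[1+ n ] = fromℤ-⊖ m (suc n)
  fromℤ-+ -[1+ m ] (+ n) = trans (fromℤ-⊖ n (suc m)) (+-comm _ _)
  fromℤ-+ -[1+ m ] -[1+ n ] = begin
    - (suc (suc (m ℕ.+ n)) · 1#)        ≡⟨ ≡.cong (λ k → - (suc k · 1#)) (ℕₚ.+-suc m n) ⟨
    - ((suc m ℕ.+ suc n) · 1#)          ≈⟨ -‿cong (×-homo-+ 1# (suc m) (suc n)) ⟩
    - (suc m · 1# + suc n · 1#)         ≈⟨ ⁻¹-∙-comm _ _ ⟨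
    - (suc m · 1#) - suc n · 1#         ∎

  fromℤ-neg : ∀ i → fromℤ (ℤ.- i) ≈ - fromℤ i
  fromℤ-neg (+ zero)  = sym -0#≈0#
  fromℤ-neg (+ suc n) = refl
  fromℤ-neg -[1+ n ]  = sym (-‿involutive _)

  fromℤ-* : ∀ i j → fromℤ (i ℤ.* j) ≈ fromℤ i * fromℤ j
  fromℤ-* (+ m) (+ n) = trans (reflexive (≡.cong fromℤ (≡.sym (ℤₚ.pos-* m n)))) (×1-homo-* m n)
  fromℤ-* (+ m) -[1+ n ] = begin
    fromℤ (+ m ℤ.* -[1+ n ])            ≡⟨ ≡.cong fromℤ (ℤₚ.neg-distribʳ-* (+ m) (+ suc n)) ⟨
    fromℤ (ℤ.- (+ m ℤ.* + suc n))       ≈⟨ fromℤ-neg (+ m ℤ.* + suc n) ⟩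
    - fromℤ (+ m ℤ.* + suc n)           ≈⟨ -‿cong (fromℤ-* (+ m) (+ suc n)) ⟩
    - (m · 1# * (suc n · 1#))           ≈⟨ -‿distribʳ-* _ _ ⟩
    m · 1# * - (suc n · 1#)             ∎
  fromℤ-* -[1+ m ] (+ n) = begin
    fromℤ (-[1+ m ] ℤ.* + n)            ≡⟨ ≡.cong fromℤ (ℤₚ.neg-distribˡ-* (+ suc m) (+ n)) ⟨
    fromℤ (ℤ.- (+ suc m ℤ.* + n))       ≈⟨ fromℤ-neg (+ suc m ℤ.* + n) ⟩
    - fromℤ (+ suc m ℤ.* + n)           ≈⟨ -‿cong (fromℤ-* (+ suc m) (+ n)) ⟩
    - (suc m · 1# * (n · 1#))           ≈⟨ -‿distribˡ-* _ _ ⟩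
    - (suc m · 1#) * (n · 1#)           ∎
  fromℤ-* -[1+ m ] -[1+ n ] = begin
    (suc m ℕ.* suc n) · 1#              ≈⟨ ×1-homo-* (suc m) (suc n) ⟩
    suc m · 1# * (suc n · 1#)           ≈⟨ -‿involutive _ ⟨
    - - (suc m · 1# * (suc n · 1#))     ≈⟨ -‿cong (-‿distribʳ-* _ _) ⟩
    - (suc m · 1# * - (suc n · 1#))     ≈⟨ -‿distribˡ-* _ _ ⟩
    - (suc m · 1#) * - (suc n · 1#)     ∎

  fromℤ-homomorphism : ℤ.+-*-rawRing -Raw-AlmostCommutative⟶ fromCommutativeRing R
  fromℤ-homomorphism = record
    { ⟦_⟧    = fromℤ
    ; +-homo = fromℤ-+
    ; *-homo = fromℤ-*
    ; -‿homo = fromℤ-neg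
    ; 0-homo = refl
    ; 1-homo = refl
    }

  -- Equality in the ring is not decidable, so normal forms are compared through their integer
  -- coefficients. Distinct integers may still agree in the ring, whence only a `Maybe`.
  fromℤ-≟ : ∀ i j → Maybe (fromℤ i ≈ fromℤ j)
  fromℤ-≟ i j with i ℤₚ.≟ j
  ... | yes i≡j = just (reflexive (≡.cong fromℤ i≡j))
  ... | no _    = nothing

  open import Algebra.Solver.Ring ℤ.+-*-rawRing (fromCommutativeRing R) fromℤ-homomorphism fromℤ-≟ public
    using (Polynomial; solve; _:=_; _:+_; _:*_; :-_; con)

-- The gate identities.

module Gates {c ℓ} (R : CommutativeRing c ℓ) where
  open import Data.Integer.Base using (+_)
  open CommutativeRing R
  open IntegerSolver R

  affine₂ : (α β γ x y : Carrier) → Carrier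
  affine₂ α β γ x y = α * x + β * y + γ

  -- Here h = 1/2. For bits, the factors with coefficients -1, 1, 1 vanish exactly at (v, t) = (1, 0),
  -- (u, v) = (1, 0) and (w, v) = (1, 0), and the last one at u = w = 1. If t = 1, the terms
  -- v = 0 and v = 1 with u = w = 0 cancel, which leaves (u, w) = (1, 0) and (0, 1).
  sumGate : (h t v w u m : Carrier) → Carrier
  sumGate h t v w u m =
    affine₂ (- 1#) 1# 1# v t *
    (affine₂ (h + h + h) (- (h + h + h)) h v t *
    (affine₂ (- 1#) 1# 1# u v *
    (affine₂ (- 1#) 1# 1# w v *
    (affine₂ (- 1#) (- 1#) (1# + 1#) u w * m))))

  -- x = (x + 0) is selected if t = 1, and 1 = (x + 1) - (x + 0) if t = 0.
  varGate : (h t s x m : Carrier) → Carrier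
  varGate h t s x m =
    affine₂ (- 1#) (- 1#) (1# + 1#) t s *
    (affine₂ (h + h + h) (h + h + h) (- h) t s *
    (affine₂ 1# 1# 0# x s * m))

  private
    :affine₂ : ∀ {n} (α β γ x y : Polynomial n) → Polynomial n
    :affine₂ α β γ x y = α :* x :+ β :* y :+ γ

    :0 :1 : ∀ {n} → Polynomial n
    :0 = con (+ 0)
    :1 = con (+ 1)

    :sumGate : ∀ {n} (h t v w u m : Polynomial n) → Polynomial n
    :sumGate h t v w u m =
      :affine₂ (:- :1) :1 :1 v t :*
      (:affine₂ (h :+ h :+ h) (:- (h :+ h :+ h)) h v t :*
      (:affine₂ (:- :1) :1 :1 u v :*
      (:affine₂ (:- :1) :1 :1 w v :*
      (:affine₂ (:- :1) (:- :1) (:1 :+ :1) u w :* m))))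

    :varGate : ∀ {n} (h t s x m : Polynomial n) → Polynomial n
    :varGate h t s x m =
      :affine₂ (:- :1) (:- :1) (:1 :+ :1) t s :*
      (:affine₂ (h :+ h :+ h) (h :+ h :+ h) (:- h) t s :*
      (:affine₂ :1 :1 :0 x s :* m))

    :sumGateTotal : ∀ {n} (h t e f m : Polynomial n) → Polynomial n
    :sumGateTotal h t e f m =
      ((:1 :* (:1 :* g :0 :0 :0) :+ :1 :* (e :* g :0 :0 :1)) :+
       (f  :* (:1 :* g :0 :1 :0) :+ f  :* (e :* g :0 :1 :1))) :+
      ((:1 :* (:1 :* g :1 :0 :0) :+ :1 :* (e :* g :1 :0 :1)) :+
       (f  :* (:1 :* g :1 :1 :0) :+ f  :* (e :* g :1 :1 :1)))
      where
      g = λ v w u → :sumGate h t v w u m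

  sumGateTotal : (h t e f m : Carrier) → Carrier
  sumGateTotal h t e f m =
    ((1# * (1# * g 0# 0# 0#) + 1# * (e * g 0# 0# 1#)) +
     (f  * (1# * g 0# 1# 0#) + f  * (e * g 0# 1# 1#))) +
    ((1# * (1# * g 1# 0# 0#) + 1# * (e * g 1# 0# 1#)) +
     (f  * (1# * g 1# 1# 0#) + f  * (e * g 1# 1# 1#)))
    where
    g : Carrier → Carrier → Carrier → Carrier
    g v w u = sumGate h t v w u m

  -- Here `h` is an indeterminate, which makes this an identity over the integers that the solver
  -- can check. The surplus factor `h + h` becomes 1 only in `2h-cancel`.
  sumGate-on : ∀ h e f m → sumGateTotal h 1# e f m ≈ (h + h) * ((e + f) * m)
  sumGate-on = solve 4 (λ h e f m → :sumGateTotal h :1 e f m := (h :+ h) :* ((e :+ f) :* m)) refl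

  sumGate-off : ∀ h e f m → sumGateTotal h 0# e f m ≈ (h + h) * (1# * m)
  sumGate-off = solve 4 (λ h e f m → :sumGateTotal h :0 e f m := (h :+ h) :* (:1 :* m)) refl

  varGate-on : ∀ h x m → varGate h 1# 0# x m + varGate h 1# 1# x m ≈ (h + h) * (x * m)
  varGate-on = solve 3 (λ h x m →
    :varGate h :1 :0 x m :+ :varGate h :1 :1 x m := (h :+ h) :* (x :* m)) refl

  varGate-off : ∀ h x m → varGate h 0# 0# x m + varGate h 0# 1# x m ≈ (h + h) * (1# * m)
  varGate-off = solve 3 (λ h x m →
    :varGate h :0 :0 x m :+ :varGate h :0 :1 x m := (h :+ h) :* (:1 :* m)) refl

-- Coefficient functions under convolution.

module Convolution {c ℓ} (R : CommutativeRing c ℓ) where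
  open CommutativeRing R
  open import Algebra.Properties.CommutativeSemigroup +-commutativeSemigroup using (interchange; x∙yz≈y∙xz)
  open import Relation.Binary.Reasoning.Setoid setoid

  Series : Set c
  Series = Monomial → Carrier

  infix 4 _≋_
  _≋_ : Series → Series → Set ℓ
  A ≋ B = ∀ m → A m ≈ B m

  -- With x₀ the first variable, A = Σₖ x₀ᵏ (A [ k ]) and shift A = (A - A [ 0 ]) / x₀.
  _[_] : Series → ℕ → Series
  (A [ k ]) m = A (k ∷ m)

  shift : Series → Series
  shift A []      = 0#
  shift A (k ∷ m) = A (suc k ∷ m)

  zeroˢ : Series
  zeroˢ _ = 0#

  constant : Carrier → Series
  constant a m = if isZeroMon m then a else 0#

  infixl 6 _+ˢ_
  infixl 7 _*ˢ_
  _+ˢ_ : Series → Series → Series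
  (A +ˢ B) m = A m + B m

  -- The Cauchy product, computed from A = A [ 0 ] + x₀ · shift A. Unlike the sum over `splits`, it
  -- recurses on the monomial, so the ring laws become inductions; `sumOver-splits` connects the
  -- two.
  _*ˢ_ : Series → Series → Series
  (A *ˢ B) []          = A [] * B []
  (A *ˢ B) (zero ∷ m)  = (A [ 0 ] *ˢ B [ 0 ]) m
  (A *ˢ B) (suc k ∷ m) = (A [ 0 ] *ˢ B [ suc k ]) m + (shift A *ˢ B) (k ∷ m)

  *ˢ-cong : ∀ {A A′ B B′} → A ≋ A′ → B ≋ B′ → A *ˢ B ≋ A′ *ˢ B′
  *ˢ-cong p q []          = *-cong (p []) (q [])
  *ˢ-cong p q (zero ∷ m)  = *ˢ-cong (p ∘ (0 ∷_)) (q ∘ (0 ∷_)) m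
  *ˢ-cong {A} {A′} p q (suc k ∷ m) = +-cong
    (*ˢ-cong (p ∘ (0 ∷_)) (q ∘ (suc k ∷_)) m)
    (*ˢ-cong shift-cong q (k ∷ m))
    where
    shift-cong : shift A ≋ shift A′
    shift-cong []      = refl
    shift-cong (k ∷ m) = p (suc k ∷ m)

  *ˢ-distribʳ : ∀ C A B → (A +ˢ B) *ˢ C ≋ A *ˢ C +ˢ B *ˢ C
  *ˢ-distribʳ C A B []          = distribʳ _ _ _
  *ˢ-distribʳ C A B (zero ∷ m)  = *ˢ-distribʳ (C [ 0 ]) (A [ 0 ]) (B [ 0 ]) m
  *ˢ-distribʳ C A B (suc k ∷ m) = begin
    ((A +ˢ B) [ 0 ] *ˢ C [ suc k ]) m + (shift (A +ˢ B) *ˢ C) (k ∷ m)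
      ≈⟨ +-cong (*ˢ-distribʳ (C [ suc k ]) (A [ 0 ]) (B [ 0 ]) m)
                (trans (*ˢ-cong shift-+ (λ _ → refl) (k ∷ m)) (*ˢ-distribʳ C (shift A) (shift B) (k ∷ m))) ⟩
    ((A [ 0 ] *ˢ C [ suc k ]) m + (B [ 0 ] *ˢ C [ suc k ]) m) + ((shift A *ˢ C) (k ∷ m) + (shift B *ˢ C) (k ∷ m))
      ≈⟨ interchange _ _ _ _ ⟩
    ((A [ 0 ] *ˢ C [ suc k ]) m + (shift A *ˢ C) (k ∷ m)) + ((B [ 0 ] *ˢ C [ suc k ]) m + (shift B *ˢ C) (k ∷ m)) ∎
    where
    shift-+ : shift (A +ˢ B) ≋ shift A +ˢ shift B
    shift-+ []      = sym (+-identityˡ 0#)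
    shift-+ (_ ∷ _) = refl

  -- The mirror image of the defining recursion, from B = B [ 0 ] + x₀ · shift B. Commutativity
  -- follows by matching the two.
  *ˢ-last : ∀ A B k m →
    (A *ˢ B) (suc k ∷ m) ≈ (A [ suc k ] *ˢ B [ 0 ]) m + (A *ˢ shift B) (k ∷ m)
  *ˢ-last A B zero m = +-comm _ _
  *ˢ-last A B (suc k) m = begin
    x + (shift A *ˢ B) (suc k ∷ m)                  ≈⟨ +-congˡ (*ˢ-last (shift A) B k m) ⟩
    x + (y + z)                                     ≈⟨ x∙yz≈y∙xz x y z ⟩
    y + (x + z)                                     ∎
    where
    x = (A [ 0 ] *ˢ B [ suc (suc k) ]) m
    y = (A [ suc (suc k) ] *ˢ B [ 0 ]) m
    z = (shift A *ˢ shift B) (k ∷ m)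

  *ˢ-comm : ∀ A B → A *ˢ B ≋ B *ˢ A
  *ˢ-comm A B []          = *-comm _ _
  *ˢ-comm A B (zero ∷ m)  = *ˢ-comm (A [ 0 ]) (B [ 0 ]) m
  *ˢ-comm A B (suc k ∷ m) = begin
    (A [ 0 ] *ˢ B [ suc k ]) m + (shift A *ˢ B) (k ∷ m)
      ≈⟨ +-cong (*ˢ-comm (A [ 0 ]) (B [ suc k ]) m) (*ˢ-comm (shift A) B (k ∷ m)) ⟩
    (B [ suc k ] *ˢ A [ 0 ]) m + (B *ˢ shift A) (k ∷ m)
      ≈⟨ *ˢ-last B A k m ⟨
    (B *ˢ A) (suc k ∷ m) ∎

  *ˢ-distribˡ : ∀ A B C → A *ˢ (B +ˢ C) ≋ A *ˢ B +ˢ A *ˢ C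
  *ˢ-distribˡ A B C m = begin
    (A *ˢ (B +ˢ C)) m           ≈⟨ *ˢ-comm A (B +ˢ C) m ⟩
    ((B +ˢ C) *ˢ A) m           ≈⟨ *ˢ-distribʳ A B C m ⟩
    (B *ˢ A) m + (C *ˢ A) m     ≈⟨ +-cong (*ˢ-comm B A m) (*ˢ-comm C A m) ⟩
    (A *ˢ B) m + (A *ˢ C) m     ∎

  *ˢ-zeroˡ : ∀ B → zeroˢ *ˢ B ≋ zeroˢ
  *ˢ-zeroˡ B []          = zeroˡ _
  *ˢ-zeroˡ B (zero ∷ m)  = *ˢ-zeroˡ (B [ 0 ]) m
  *ˢ-zeroˡ B (suc k ∷ m) = begin
    (zeroˢ *ˢ B [ suc k ]) m + (shift zeroˢ *ˢ B) (k ∷ m)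
      ≈⟨ +-cong (*ˢ-zeroˡ (B [ suc k ]) m) (*ˢ-cong shift-0 (λ _ → refl) (k ∷ m)) ⟩
    0# + (zeroˢ *ˢ B) (k ∷ m) ≈⟨ +-identityˡ _ ⟩
    (zeroˢ *ˢ B) (k ∷ m)      ≈⟨ *ˢ-zeroˡ B (k ∷ m) ⟩
    0#                        ∎
    where
    shift-0 : shift zeroˢ ≋ zeroˢ
    shift-0 []      = refl
    shift-0 (_ ∷ _) = refl

  shift-constant : ∀ a → shift (constant a) ≋ zeroˢ
  shift-constant a []      = refl
  shift-constant a (_ ∷ _) = refl

  constant-*ˢ : ∀ a B m → (constant a *ˢ B) m ≈ a * B m
  constant-*ˢ a B []          = refl
  constant-*ˢ a B (zero ∷ m)  = constant-*ˢ a (B [ 0 ]) m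
  constant-*ˢ a B (suc k ∷ m) = begin
    (constant a *ˢ B [ suc k ]) m + (shift (constant a) *ˢ B) (k ∷ m)
      ≈⟨ +-cong (constant-*ˢ a (B [ suc k ]) m) (*ˢ-cong (shift-constant a) (λ _ → refl) (k ∷ m)) ⟩
    a * B (suc k ∷ m) + (zeroˢ *ˢ B) (k ∷ m)  ≈⟨ +-congˡ (*ˢ-zeroˡ B (k ∷ m)) ⟩
    a * B (suc k ∷ m) + 0#                    ≈⟨ +-identityʳ _ ⟩
    a * B (suc k ∷ m)                         ∎

  -- The product with a series free of x₀, whose monomials start at the second variable. It arises
  -- because shift (A B) = A [ 0 ] · shift B + shift A · B.
  scale₀ : Series → Series → Series
  scale₀ A B []      = 0#
  scale₀ A B (k ∷ m) = (A *ˢ B [ k ]) m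

  -- A product at `k ∷ m` never reads `A []`. Away from `[]` the formula for the shift of a product
  -- holds by `refl`; at `[]` its two sides agree only up to ring laws.
  *ˢ-cong-∷ : ∀ {A A′ B} → (∀ k → A [ k ] ≋ A′ [ k ]) → ∀ k m → (A *ˢ B) (k ∷ m) ≈ (A′ *ˢ B) (k ∷ m)
  *ˢ-cong-∷ p zero m = *ˢ-cong (p 0) (λ _ → refl) m
  *ˢ-cong-∷ {A} {A′} {B} p (suc k) m = +-cong (*ˢ-cong (p 0) (λ _ → refl) m) (*ˢ-cong-∷ {shift A} {shift A′} {B} (p ∘ suc) k m)

  mutual
    *ˢ-assoc : ∀ A B C → (A *ˢ B) *ˢ C ≋ A *ˢ (B *ˢ C)
    *ˢ-assoc A B C []          = *-assoc _ _ _
    *ˢ-assoc A B C (zero ∷ m)  = *ˢ-assoc (A [ 0 ]) (B [ 0 ]) (C [ 0 ]) m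
    *ˢ-assoc A B C (suc k ∷ m) = begin
      ((A [ 0 ] *ˢ B [ 0 ]) *ˢ C [ suc k ]) m + (shift (A *ˢ B) *ˢ C) (k ∷ m)
        ≈⟨ +-cong (*ˢ-assoc (A [ 0 ]) (B [ 0 ]) (C [ suc k ]) m)
             (*ˢ-cong-∷ {shift (A *ˢ B)} {scale₀ (A [ 0 ]) (shift B) +ˢ shift A *ˢ B} {C} (λ _ _ → refl) k m) ⟩
      x + ((scale₀ (A [ 0 ]) (shift B) +ˢ shift A *ˢ B) *ˢ C) (k ∷ m)
        ≈⟨ +-congˡ (*ˢ-distribʳ C (scale₀ (A [ 0 ]) (shift B)) (shift A *ˢ B) (k ∷ m)) ⟩
      x + ((scale₀ (A [ 0 ]) (shift B) *ˢ C) (k ∷ m) + ((shift A *ˢ B) *ˢ C) (k ∷ m))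
        ≈⟨ +-congˡ (+-cong (scale₀-assoc (A [ 0 ]) (shift B) C k m) (*ˢ-assoc (shift A) B C (k ∷ m))) ⟩
      x + ((A [ 0 ] *ˢ (shift B *ˢ C) [ k ]) m + z)
        ≈⟨ +-assoc _ _ _ ⟨
      (x + (A [ 0 ] *ˢ (shift B *ˢ C) [ k ]) m) + z
        ≈⟨ +-congʳ (*ˢ-distribˡ (A [ 0 ]) (B [ 0 ] *ˢ C [ suc k ]) ((shift B *ˢ C) [ k ]) m) ⟨
      (A [ 0 ] *ˢ (B *ˢ C) [ suc k ]) m + z ∎
      where
      x = (A [ 0 ] *ˢ (B [ 0 ] *ˢ C [ suc k ])) m
      z = (shift A *ˢ (B *ˢ C)) (k ∷ m)

    -- Reassociates the part A [ 0 ] · shift B of the shift of A B, the one term of `*ˢ-assoc` that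
    -- is not an instance of associativity for smaller monomials.
    scale₀-assoc : ∀ A B C k m → (scale₀ A B *ˢ C) (k ∷ m) ≈ (A *ˢ (B *ˢ C) [ k ]) m
    scale₀-assoc A B C zero m    = *ˢ-assoc A (B [ 0 ]) (C [ 0 ]) m
    scale₀-assoc A B C (suc k) m = begin
      ((A *ˢ B [ 0 ]) *ˢ C [ suc k ]) m + (shift (scale₀ A B) *ˢ C) (k ∷ m)
        ≈⟨ +-cong (*ˢ-assoc A (B [ 0 ]) (C [ suc k ]) m)
             (trans (*ˢ-cong-∷ {shift (scale₀ A B)} {scale₀ A (shift B)} {C} (λ _ _ → refl) k m) (scale₀-assoc A (shift B) C k m)) ⟩
      (A *ˢ (B [ 0 ] *ˢ C [ suc k ])) m + (A *ˢ (shift B *ˢ C) [ k ]) m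
        ≈⟨ *ˢ-distribˡ A (B [ 0 ] *ˢ C [ suc k ]) ((shift B *ˢ C) [ k ]) m ⟨
      (A *ˢ (B *ˢ C) [ suc k ]) m ∎

  sumOver : ∀ {a} {A : Set a} → (A → Carrier) → List A → Carrier
  sumOver f = foldr (λ x acc → f x + acc) 0#

  sumOver-++ : ∀ {a} {A : Set a} (f : A → Carrier) xs ys → sumOver f (xs ++ ys) ≈ sumOver f xs + sumOver f ys
  sumOver-++ f []       ys = sym (+-identityˡ _)
  sumOver-++ f (x ∷ xs) ys = trans (+-congˡ (sumOver-++ f xs ys)) (sym (+-assoc _ _ _))

  sumOver-cong : ∀ {a} {A : Set a} {f g : A → Carrier} → (∀ x → f x ≈ g x) → ∀ xs → sumOver f xs ≈ sumOver g xs
  sumOver-cong p []       = refl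
  sumOver-cong p (x ∷ xs) = +-cong (p x) (sumOver-cong p xs)

  sumOver-concatMap : ∀ {a b} {A : Set a} {B : Set b} (f : B → Carrier) (g : A → List B) xs →
    sumOver f (concatMap g xs) ≈ sumOver (sumOver f ∘ g) xs
  sumOver-concatMap f g []       = refl
  sumOver-concatMap f g (x ∷ xs) = trans (sumOver-++ f (g x) (concatMap g xs)) (+-congˡ (sumOver-concatMap f g xs))

  sumOver-map : ∀ {a b} {A : Set a} {B : Set b} (f : B → Carrier) (g : A → B) xs →
    sumOver f (map g xs) ≡ sumOver (f ∘ g) xs
  sumOver-map f g []       = ≡.refl
  sumOver-map f g (x ∷ xs) = ≡.cong (f (g x) +_) (sumOver-map f g xs)

  sumOver-applyUpTo : ∀ {a} {A : Set a} (f : A → Carrier) (g : ℕ → A) (h : ℕ → ℕ) n →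
    sumOver f (applyUpTo (g ∘ h) n) ≡ sumOver (f ∘ g) (applyUpTo h n)
  sumOver-applyUpTo f g h zero    = ≡.refl
  sumOver-applyUpTo f g h (suc n) = ≡.cong (f (g (h 0)) +_) (sumOver-applyUpTo f g (h ∘ suc) n)

  splitProduct : Series → Series → Monomial × Monomial → Carrier
  splitProduct A B (m₁ , m₂) = A m₁ * B m₂

  -- In the sum over the exponents a ≤ k of x₀, the term a = 0 is the first summand of the
  -- recursion; the terms with a > 0, reindexed, form the same sum for `shift A`.
  sumOver-splits : ∀ A B m → sumOver (splitProduct A B) (splits m) ≈ (A *ˢ B) m
  sumOver-splits A B []      = +-identityʳ _
  sumOver-splits A B (k ∷ m) = trans (sumOver-concatMap (splitProduct A B)
      (λ a → map (λ p → a ∷ proj₁ p , (k ∸ a) ∷ proj₂ p) (splits m)) (upTo (suc k)))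
    (trans (sumOver-cong (λ a → trans (reflexive (sumOver-map (splitProduct A B) _ (splits m)))
       (sumOver-splits (A [ a ]) (B [ k ∸ a ]) m)) (upTo (suc k)))
     (cauchy A k))
    where
    cauchy : ∀ A k → sumOver (λ a → (A [ a ] *ˢ B [ k ∸ a ]) m) (upTo (suc k)) ≈ (A *ˢ B) (k ∷ m)
    cauchy A zero    = +-identityʳ _
    cauchy A (suc k) = +-congˡ (trans
      (reflexive (sumOver-applyUpTo (λ a → (A [ a ] *ˢ B [ suc k ∸ a ]) m) suc id (suc k)))
      (cauchy (shift A) k))

-- Substitution into expressions.

subst-cong : ∀ {c} {A : Set c} {σ τ : ℕ → Expr A} → σ ≗ τ → subst σ ≗ subst τ
subst-cong p (var i) = p i
subst-cong p (con a) = ≡.refl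
subst-cong p (e ⊕ f) = ≡.cong₂ _⊕_ (subst-cong p e) (subst-cong p f)
subst-cong p (e ⊗ f) = ≡.cong₂ _⊗_ (subst-cong p e) (subst-cong p f)

subst-var : ∀ {c} {A : Set c} (e : Expr A) → subst var e ≡ e
subst-var (var i) = ≡.refl
subst-var (con a) = ≡.refl
subst-var (e ⊕ f) = ≡.cong₂ _⊕_ (subst-var e) (subst-var f)
subst-var (e ⊗ f) = ≡.cong₂ _⊗_ (subst-var e) (subst-var f)

subst-∘ : ∀ {c} {A : Set c} (σ τ : ℕ → Expr A) e → subst σ (subst τ e) ≡ subst (subst σ ∘ τ) e
subst-∘ σ τ (var i) = ≡.refl
subst-∘ σ τ (con a) = ≡.refl
subst-∘ σ τ (e ⊕ f) = ≡.cong₂ _⊕_ (subst-∘ σ τ e) (subst-∘ σ τ f)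
subst-∘ σ τ (e ⊗ f) = ≡.cong₂ _⊗_ (subst-∘ σ τ e) (subst-∘ σ τ f)

-- The polynomial ring, and evaluation of its first variable.

module PolynomialRing {c ℓ} (F : Field c ℓ) where
  open Field F
  open Poly F
  open Convolution commutativeRing
  open import Algebra.Properties.Ring ring using (-1*x≈-x)
  open import Algebra.Properties.CommutativeSemigroup +-commutativeSemigroup using (interchange)
  open import Relation.Binary.Reasoning.Setoid setoid

  coeff-⊗ : ∀ e f → coeff (e ⊗ f) ≋ coeff e *ˢ coeff f
  coeff-⊗ e f m = sumOver-splits (coeff e) (coeff f) m

  coeff-con-⊗ : ∀ a e m → coeff (con a ⊗ e) m ≈ a * coeff e m
  coeff-con-⊗ a e m = trans (coeff-⊗ (con a) e m) (constant-*ˢ a (coeff e) m)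

  constant-scale : ∀ a b m → constant (a * b) m ≈ a * constant b m
  constant-scale a b m with isZeroMon m
  ... | true  = refl
  ... | false = sym (zeroʳ a)

  constant-0 : ∀ m → coeff (con 0#) m ≈ 0#
  constant-0 m with isZeroMon m
  ... | true  = refl
  ... | false = refl

  ⊗-cong : ∀ {e e′ f f′} → e ≈ₚ e′ → f ≈ₚ f′ → (e ⊗ f) ≈ₚ (e′ ⊗ f′)
  ⊗-cong {e} {e′} {f} {f′} p q m =
    trans (coeff-⊗ e f m) (trans (*ˢ-cong p q m) (sym (coeff-⊗ e′ f′ m)))

  ⊗-comm : ∀ e f → (e ⊗ f) ≈ₚ (f ⊗ e)
  ⊗-comm e f m = trans (coeff-⊗ e f m) (trans (*ˢ-comm (coeff e) (coeff f) m) (sym (coeff-⊗ f e m)))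

  ⊗-assoc : ∀ e f g → ((e ⊗ f) ⊗ g) ≈ₚ (e ⊗ (f ⊗ g))
  ⊗-assoc e f g m = begin
    coeff ((e ⊗ f) ⊗ g) m                   ≈⟨ coeff-⊗ (e ⊗ f) g m ⟩
    (coeff (e ⊗ f) *ˢ coeff g) m            ≈⟨ *ˢ-cong (coeff-⊗ e f) (λ _ → refl) m ⟩
    ((coeff e *ˢ coeff f) *ˢ coeff g) m     ≈⟨ *ˢ-assoc (coeff e) (coeff f) (coeff g) m ⟩
    (coeff e *ˢ (coeff f *ˢ coeff g)) m     ≈⟨ *ˢ-cong {coeff e} (λ _ → refl) (coeff-⊗ f g) m ⟨
    (coeff e *ˢ coeff (f ⊗ g)) m            ≈⟨ coeff-⊗ e (f ⊗ g) m ⟨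
    coeff (e ⊗ (f ⊗ g)) m                   ∎

  ⊗-distribʳ : ∀ g e f → ((e ⊕ f) ⊗ g) ≈ₚ ((e ⊗ g) ⊕ (f ⊗ g))
  ⊗-distribʳ g e f m = begin
    coeff ((e ⊕ f) ⊗ g) m                                    ≈⟨ coeff-⊗ (e ⊕ f) g m ⟩
    ((coeff e +ˢ coeff f) *ˢ coeff g) m                      ≈⟨ *ˢ-distribʳ (coeff g) (coeff e) (coeff f) m ⟩
    (coeff e *ˢ coeff g) m + (coeff f *ˢ coeff g) m          ≈⟨ +-cong (coeff-⊗ e g m) (coeff-⊗ f g m) ⟨
    coeff (e ⊗ g) m + coeff (f ⊗ g) m                        ∎

  ⊗-identityˡ : ∀ e → (con 1# ⊗ e) ≈ₚ e
  ⊗-identityˡ e m = trans (coeff-con-⊗ 1# e m) (*-identityˡ _)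

  -ₚ_ : E → E
  -ₚ e = con (- 1#) ⊗ e

  -ₚ-inverseʳ : ∀ e → (e ⊕ (-ₚ e)) ≈ₚ con 0#
  -ₚ-inverseʳ e m = begin
    coeff e m + coeff (con (- 1#) ⊗ e) m ≈⟨ +-congˡ (coeff-con-⊗ (- 1#) e m) ⟩
    coeff e m + - 1# * coeff e m         ≈⟨ +-congˡ (-1*x≈-x _) ⟩
    coeff e m - coeff e m                ≈⟨ -‿inverseʳ _ ⟩
    0#                                   ≈⟨ constant-0 m ⟨
    coeff (con 0#) m                     ∎

  -- A record, so that the two polynomials can be inferred from a proof of their equality.
  infix 4 _≅_
  record _≅_ (e f : E) : Set ℓ where
    constructor equalCoeffs
    field coeffs-≈ : e ≈ₚ f
  open _≅_ public

  polynomialRing : CommutativeRing c ℓ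
  polynomialRing = record
    { Carrier = E
    ; _≈_ = _≅_
    ; _+_ = _⊕_
    ; _*_ = _⊗_
    ; -_  = -ₚ_
    ; 0#  = con 0#
    ; 1#  = con 1#
    ; isCommutativeRing = record
      { isRing = record
        { +-isAbelianGroup = record
          { isGroup = record
            { isMonoid = record
              { isSemigroup = record
                { isMagma = record
                  { isEquivalence = record
                    { refl  = equalCoeffs λ _ → refl
                    ; sym   = λ (equalCoeffs p) → equalCoeffs λ m → sym (p m)
                    ; trans = λ (equalCoeffs p) (equalCoeffs q) → equalCoeffs λ m → trans (p m) (q m)
                    }
                  ; ∙-cong = λ (equalCoeffs p) (equalCoeffs q) → equalCoeffs λ m → +-cong (p m) (q m)
                  }
                ; assoc = λ e f g → equalCoeffs λ m → +-assoc _ _ _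
                }
              ; identity = (λ e → equalCoeffs (⊕-identityˡ e)) , λ e → equalCoeffs λ m → trans (+-comm _ _) (⊕-identityˡ e m)
              }
            ; inverse = (λ e → equalCoeffs λ m → trans (+-comm _ _) (-ₚ-inverseʳ e m)) , λ e → equalCoeffs (-ₚ-inverseʳ e)
            ; ⁻¹-cong = λ {e} {f} (equalCoeffs p) → equalCoeffs (⊗-cong {con (- 1#)} {con (- 1#)} {e} {f} (λ _ → refl) p)
            }
          ; comm = λ e f → equalCoeffs λ m → +-comm _ _
          }
        ; *-cong = λ {e} {e′} {f} {f′} (equalCoeffs p) (equalCoeffs q) → equalCoeffs (⊗-cong {e} {e′} {f} {f′} p q)
        ; *-assoc = λ e f g → equalCoeffs (⊗-assoc e f g)
        ; *-identity = (λ e → equalCoeffs (⊗-identityˡ e)) , λ e → equalCoeffs λ m → trans (⊗-comm e (con 1#) m) (⊗-identityˡ e m)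
        ; distrib = (λ e f g → equalCoeffs λ m → trans (⊗-comm e (f ⊕ g) m)
                      (trans (⊗-distribʳ e f g m) (+-cong (⊗-comm f e m) (⊗-comm g e m))))
                  , λ e f g → equalCoeffs (⊗-distribʳ e f g)
        }
      ; *-comm = λ e f → equalCoeffs (⊗-comm e f)
      }
    }
    where
    ⊕-identityˡ : ∀ e → (con 0# ⊕ e) ≈ₚ e
    ⊕-identityˡ e m = trans (+-congʳ (constant-0 m)) (+-identityˡ _)

  con-cong : ∀ {a b} → a ≈ b → con a ≅ con b
  con-cong {a} {b} a≈b = equalCoeffs go
    where
    go : con a ≈ₚ con b
    go m with isZeroMon m
    ... | true  = a≈b
    ... | false = refl

  con-+ : ∀ a b → con (a + b) ≅ (con a ⊕ con b)
  con-+ a b = equalCoeffs go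
    where
    go : con (a + b) ≈ₚ (con a ⊕ con b)
    go m with isZeroMon m
    ... | true  = refl
    ... | false = sym (+-identityˡ 0#)

  con-* : ∀ a b → con (a * b) ≅ (con a ⊗ con b)
  con-* a b = equalCoeffs λ m → trans (constant-scale a b m) (sym (coeff-con-⊗ a (con b) m))

  *ˢ-scale : ∀ b A B → A *ˢ (λ m → b * B m) ≋ (λ m → b * (A *ˢ B) m)
  *ˢ-scale b A B m = begin
    (A *ˢ (λ m → b * B m)) m                ≈⟨ *ˢ-cong {A} (λ _ → refl) (λ m → sym (constant-*ˢ b B m)) m ⟩
    (A *ˢ (constant b *ˢ B)) m              ≈⟨ *ˢ-assoc A (constant b) B m ⟨
    ((A *ˢ constant b) *ˢ B) m              ≈⟨ *ˢ-cong (*ˢ-comm A (constant b)) (λ _ → refl) m ⟩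
    ((constant b *ˢ A) *ˢ B) m              ≈⟨ *ˢ-assoc (constant b) A B m ⟩
    (constant b *ˢ (A *ˢ B)) m              ≈⟨ constant-*ˢ b (A *ˢ B) m ⟩
    b * (A *ˢ B) m                          ∎

  -- Evaluates a A R says that A is a polynomial in x₀ over the other variables, with value R at x₀ = a.
  data Evaluates (a : Carrier) : Series → Series → Set (c ⊔ ℓ) where
    vanishes : ∀ {A R} → (∀ k → A [ k ] ≋ zeroˢ) → R ≋ zeroˢ → Evaluates a A R
    horner   : ∀ {A R S} → Evaluates a (shift A) S → (∀ m → R m ≈ A (0 ∷ m) + a * S m) → Evaluates a A R

  module _ {a : Carrier} where
    evaluates-shift : ∀ {A R} → Evaluates a A R →
      ∃[ S ] Evaluates a (shift A) S × (∀ m → R m ≈ A (0 ∷ m) + a * S m)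
    evaluates-shift (vanishes A≋0 R≋0) = zeroˢ , vanishes (A≋0 ∘ suc) (λ _ → refl) , λ m →
      trans (R≋0 m) (sym (trans (+-cong (A≋0 0 m) (zeroʳ a)) (+-identityˡ 0#)))
    evaluates-shift (horner A⇝S eq) = _ , A⇝S , eq

    evaluates-zero : ∀ {A R} → (∀ k → A [ k ] ≋ zeroˢ) → Evaluates a A R → R ≋ zeroˢ
    evaluates-zero A≋0 (vanishes _ R≋0) = R≋0
    evaluates-zero A≋0 (horner A⇝S eq) m = trans (eq m)
      (trans (+-cong (A≋0 0 m) (trans (*-congˡ (evaluates-zero (A≋0 ∘ suc) A⇝S m)) (zeroʳ a))) (+-identityˡ 0#))

    -- The two Horner schemes may have different lengths. Where one has ended, its series is zero,
    -- so the rest of the other evaluates to zero as well.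
    evaluates-unique : ∀ {A B R S} → (∀ k → A [ k ] ≋ B [ k ]) → Evaluates a A R → Evaluates a B S → R ≋ S
    evaluates-unique A≋B (vanishes A≋0 R≋0) B⇝S m =
      trans (R≋0 m) (sym (evaluates-zero (λ k m → trans (sym (A≋B k m)) (A≋0 k m)) B⇝S m))
    evaluates-unique A≋B (horner A⇝R eq) B⇝S m with evaluates-shift B⇝S
    ... | S , B′⇝S , eq′ = trans (eq m)
      (trans (+-cong (A≋B 0 m) (*-congˡ (evaluates-unique (A≋B ∘ suc) A⇝R B′⇝S m))) (sym (eq′ m)))

    evaluates-resp : ∀ {A B R S} → (∀ k → A [ k ] ≋ B [ k ]) → R ≋ S → Evaluates a A R → Evaluates a B S
    evaluates-resp A≋B R≋S (vanishes A≋0 R≋0) =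
      vanishes (λ k m → trans (sym (A≋B k m)) (A≋0 k m)) (λ m → trans (sym (R≋S m)) (R≋0 m))
    evaluates-resp A≋B R≋S (horner A⇝R eq) =
      horner (evaluates-resp (A≋B ∘ suc) (λ _ → refl) A⇝R) (λ m → trans (sym (R≋S m)) (trans (eq m) (+-congʳ (A≋B 0 m))))

    evaluates-constant : ∀ A → (∀ k → A [ suc k ] ≋ zeroˢ) → Evaluates a A (A [ 0 ])
    evaluates-constant A A′≋0 = horner {S = zeroˢ} (vanishes A′≋0 (λ _ → refl))
      (λ m → sym (trans (+-congˡ (zeroʳ a)) (+-identityʳ _)))

    evaluates-+ : ∀ {A B R S} → Evaluates a A R → Evaluates a B S → Evaluates a (A +ˢ B) (R +ˢ S)
    evaluates-+ {A} {B} (vanishes A≋0 R≋0) B⇝S = evaluates-resp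
      (λ k m → sym (trans (+-congʳ (A≋0 k m)) (+-identityˡ _))) (λ m → sym (trans (+-congʳ (R≋0 m)) (+-identityˡ _))) B⇝S
    evaluates-+ {A} {B} {R} {S} (horner {S = R′} A⇝R′ eq) B⇝S with evaluates-shift B⇝S
    ... | S′ , B⇝S′ , eq′ = horner
      (evaluates-resp (λ _ _ → refl) (λ _ → refl) (evaluates-+ A⇝R′ B⇝S′)) λ m → begin
        R m + S m ≈⟨ +-cong (eq m) (eq′ m) ⟩
        (A (0 ∷ m) + a * R′ m) + (B (0 ∷ m) + a * S′ m) ≈⟨ interchange _ _ _ _ ⟩
        (A (0 ∷ m) + B (0 ∷ m)) + (a * R′ m + a * S′ m) ≈⟨ +-congˡ (distribˡ a _ _) ⟨
        (A (0 ∷ m) + B (0 ∷ m)) + a * (R′ m + S′ m) ∎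

    evaluates-scale₀ : ∀ {A B S} → Evaluates a B S → Evaluates a (scale₀ A B) (A *ˢ S)
    evaluates-scale₀ {A} (vanishes B≋0 S≋0) = vanishes
      (λ k m → zeroʳˢ (B≋0 k) m) (zeroʳˢ S≋0)
      where
      zeroʳˢ : ∀ {B} → B ≋ zeroˢ → A *ˢ B ≋ zeroˢ
      zeroʳˢ {B} p m = trans (*ˢ-cong {A} (λ _ → refl) p m) (trans (*ˢ-comm A zeroˢ m) (*ˢ-zeroˡ A m))
    evaluates-scale₀ {A} {B} {S} (horner {S = S′} B⇝S′ eq) = horner
      (evaluates-resp (λ _ _ → refl) (λ _ → refl) (evaluates-scale₀ {A} B⇝S′)) λ m → begin
        (A *ˢ S) m                                        ≈⟨ *ˢ-cong {A} (λ _ → refl) eq m ⟩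
        (A *ˢ (B [ 0 ] +ˢ (λ m → a * S′ m))) m            ≈⟨ *ˢ-distribˡ A (B [ 0 ]) _ m ⟩
        (A *ˢ B [ 0 ]) m + (A *ˢ (λ m → a * S′ m)) m      ≈⟨ +-congˡ (*ˢ-scale a A S′ m) ⟩
        (A *ˢ B [ 0 ]) m + a * (A *ˢ S′) m                ∎

    -- With R = A₀ + a R′ and S = B₀ + a S′, expanding S only next to A₀ gives R S = A₀ B₀ + a (A₀
    -- S′ + R′ S). This matches the shift of A B, and the induction follows the scheme of A alone.
    evaluates-* : ∀ {A B R S} → Evaluates a A R → Evaluates a B S → Evaluates a (A *ˢ B) (R *ˢ S)
    evaluates-* {A} {B} {R} {S} (vanishes A≋0 R≋0) B⇝S = vanishes
      (λ k m → trans (*ˢ-cong-∷ {A} {zeroˢ} {B} A≋0 k m) (*ˢ-zeroˡ B (k ∷ m)))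
      (λ m → trans (*ˢ-cong R≋0 (λ _ → refl) m) (*ˢ-zeroˡ S m))
    evaluates-* {A} {B} {R} {S} (horner {S = R′} A⇝R′ eq) B⇝S with evaluates-shift B⇝S
    ... | S′ , B⇝S′ , eq′ = horner
      (evaluates-resp (λ _ _ → refl) (λ _ → refl) (evaluates-+ (evaluates-scale₀ {A [ 0 ]} B⇝S′) (evaluates-* A⇝R′ B⇝S))) λ m → begin
        (R *ˢ S) m
          ≈⟨ *ˢ-cong eq (λ _ → refl) m ⟩
        ((A [ 0 ] +ˢ (λ m → a * R′ m)) *ˢ S) m
          ≈⟨ *ˢ-distribʳ S (A [ 0 ]) _ m ⟩
        (A [ 0 ] *ˢ S) m + ((λ m → a * R′ m) *ˢ S) m
          ≈⟨ +-cong (*ˢ-cong {A [ 0 ]} (λ _ → refl) eq′ m) (*ˢ-comm _ S m) ⟩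
        (A [ 0 ] *ˢ (B [ 0 ] +ˢ (λ m → a * S′ m))) m + (S *ˢ (λ m → a * R′ m)) m
          ≈⟨ +-cong (*ˢ-distribˡ (A [ 0 ]) (B [ 0 ]) _ m) (*ˢ-scale a S R′ m) ⟩
        ((A [ 0 ] *ˢ B [ 0 ]) m + (A [ 0 ] *ˢ (λ m → a * S′ m)) m) + a * (S *ˢ R′) m
          ≈⟨ +-cong (+-congˡ (*ˢ-scale a (A [ 0 ]) S′ m)) (*-congˡ (*ˢ-comm S R′ m)) ⟩
        ((A [ 0 ] *ˢ B [ 0 ]) m + a * (A [ 0 ] *ˢ S′) m) + a * (R′ *ˢ S) m
          ≈⟨ +-assoc _ _ _ ⟩
        (A [ 0 ] *ˢ B [ 0 ]) m + (a * (A [ 0 ] *ˢ S′) m + a * (R′ *ˢ S) m)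
          ≈⟨ +-congˡ (distribˡ a _ _) ⟨
        (A [ 0 ] *ˢ B [ 0 ]) m + a * ((A [ 0 ] *ˢ S′) m + (R′ *ˢ S) m) ∎

  infixr 5 _▹_
  _▹_ : E → (ℕ → E) → ℕ → E
  (e ▹ σ) zero    = e
  (e ▹ σ) (suc i) = σ i

  evaluates-subst : ∀ a e → Evaluates a (coeff e) (coeff (subst (con a ▹ var) e))
  evaluates-subst a (var zero) = horner {S = constant 1#}
    (evaluates-constant _ (λ _ _ → refl))
    λ m → trans (trans (coeffs-≈ (con-cong (sym (*-identityʳ a))) m) (constant-scale a 1# m)) (sym (+-identityˡ _))
  evaluates-subst a (var (suc i)) =
    evaluates-constant _ (λ _ _ → refl)
  evaluates-subst a (con b) =
    evaluates-constant _ (λ _ _ → refl)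
  evaluates-subst a (e ⊕ f) = evaluates-+ (evaluates-subst a e) (evaluates-subst a f)
  evaluates-subst a (e ⊗ f) = evaluates-resp
    (λ k m → sym (coeff-⊗ e f (k ∷ m))) (λ m → sym (coeff-⊗ (subst (con a ▹ var) e) (subst (con a ▹ var) f) m))
    (evaluates-* (evaluates-subst a e) (evaluates-subst a f))

  -- `subst` works on syntax, but by `evaluates-subst` its result is a value of the coefficient
  -- series, and such a value is unique.
  subst-con-cong : ∀ a {e f} → e ≅ f → subst (con a ▹ var) e ≅ subst (con a ▹ var) f
  subst-con-cong a {e} {f} (equalCoeffs e≈f) =
    equalCoeffs (evaluates-unique (λ k m → e≈f (k ∷ m)) (evaluates-subst a e) (evaluates-subst a f))

  subst-plug-[] : ∀ e → subst (plug []) e ≡ e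
  subst-plug-[] e = ≡.trans (subst-cong (λ _ → ≡.refl) e) (subst-var e)

  subst-plug-∷ : ∀ b bs e → subst (plug (b ∷ bs)) e ≡ subst (plug bs) (subst (con (bit b) ▹ var) e)
  subst-plug-∷ b bs e = ≡.sym (≡.trans (subst-∘ _ _ e) (subst-cong (λ { zero → ≡.refl ; (suc i) → ≡.refl }) e))

  subst-plug-cong : ∀ bs {e f} → e ≅ f → subst (plug bs) e ≅ subst (plug bs) f
  subst-plug-cong [] {e} {f} e≅f rewrite subst-plug-[] e | subst-plug-[] f = e≅f
  subst-plug-cong (b ∷ bs) {e} {f} e≅f rewrite subst-plug-∷ b bs e | subst-plug-∷ b bs f =
    subst-plug-cong bs (subst-con-cong (bit b) e≅f)

-- Sums over the hypercube, one bit at a time.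

module HypercubeSums {c ℓ} (F : Field c ℓ) where
  open Field F using (Carrier; 0#; 1#)
  open Poly F
  open PolynomialRing F
  open CommutativeRing polynomialRing hiding (Carrier; 0#; 1#)
  open import Relation.Binary.Reasoning.Setoid setoid

  elim : E → E
  elim e = subst (con 0# ▹ var) e ⊕ subst (con 1# ▹ var) e

  elims : ℕ → E → E
  elims zero    e = e
  elims (suc k) e = elims k (elim e)

  elims-+ : ∀ j k e → elims (j ℕ.+ k) e ≡ elims k (elims j e)
  elims-+ zero    k e = ≡.refl
  elims-+ (suc j) k e = elims-+ j k (elim e)

  -- `allBits` varies the first bit fastest, so the two strings that differ only there are adjacent
  -- and pair up into `elim`.
  hsum-suc : ∀ k e → hsum (suc k) e ≈ hsum k (elim e)
  hsum-suc k e = go (allBits k)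
    where
    go : ∀ bss → sum (map (λ bs → subst (plug bs) e) (concatMap (λ bs → (false ∷ bs) ∷ (true ∷ bs) ∷ []) bss))
               ≈ sum (map (λ bs → subst (plug bs) (elim e)) bss)
    go []         = refl
    go (bs ∷ bss) = trans
      (sym (+-assoc _ _ _))
      (+-cong (+-cong (reflexive (subst-plug-∷ false bs e)) (reflexive (subst-plug-∷ true bs e))) (go bss))

  hsum-elims : ∀ k e → hsum k e ≈ elims k e
  hsum-elims zero    e = trans (+-identityʳ _) (reflexive (subst-plug-[] e))
  hsum-elims (suc k) e = trans (hsum-suc k e) (hsum-elims k (elim e))

  hsum-cong : ∀ k {e f} → e ≈ f → hsum k e ≈ hsum k f
  hsum-cong k {e} {f} e≈f = go (allBits k)
    where
    go : ∀ bss → sum (map (λ bs → subst (plug bs) e) bss) ≈ sum (map (λ bs → subst (plug bs) f) bss)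
    go []         = refl
    go (bs ∷ bss) = +-cong (subst-plug-cong bs e≈f) (go bss)

  hsum-+ : ∀ j k e → hsum (j ℕ.+ k) e ≈ hsum k (hsum j e)
  hsum-+ j k e = begin
    hsum (j ℕ.+ k) e     ≈⟨ hsum-elims (j ℕ.+ k) e ⟩
    elims (j ℕ.+ k) e    ≡⟨ elims-+ j k e ⟩
    elims k (elims j e)  ≈⟨ hsum-elims k (elims j e) ⟨
    hsum k (elims j e)   ≈⟨ hsum-cong k (hsum-elims j e) ⟨
    hsum k (hsum j e)    ∎

  subst-elim : ∀ σ e → subst σ (elim e) ≡ subst (con 0# ▹ σ) e ⊕ subst (con 1# ▹ σ) e
  subst-elim σ e = ≡.cong₂ _⊕_ (lemma 0#) (lemma 1#)
    where
    lemma : ∀ a → subst σ (subst (con a ▹ var) e) ≡ subst (con a ▹ σ) e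
    lemma a = ≡.trans (subst-∘ _ _ e) (subst-cong (λ { zero → ≡.refl ; (suc i) → ≡.refl }) e)

  -- A factor that is the same for all values of the summed variables leaves the sum. Quantifying
  -- over every extension τ of σ lets the induction pass below each `elim`.
  elims-factor : ∀ k {σ c X Y} →
    (∀ τ → (∀ i → τ (k ℕ.+ i) ≡ σ i) → subst τ X ≈ c ⊗ subst τ Y) →
    subst σ (elims k X) ≈ c ⊗ subst σ (elims k Y)
  elims-factor zero p = p _ (λ _ → ≡.refl)
  elims-factor (suc k) {σ} {c} {X} {Y} p = elims-factor k λ τ q → begin
    subst τ (elim X)                                                ≡⟨ subst-elim τ X ⟩
    subst (con 0# ▹ τ) X ⊕ subst (con 1# ▹ τ) X                     ≈⟨ +-cong (p _ q) (p _ q) ⟩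
    (c ⊗ subst (con 0# ▹ τ) Y) ⊕ (c ⊗ subst (con 1# ▹ τ) Y)         ≈⟨ distribˡ c _ _ ⟨
    c ⊗ (subst (con 0# ▹ τ) Y ⊕ subst (con 1# ▹ τ) Y)               ≡⟨ ≡.cong (c ⊗_) (subst-elim τ Y) ⟨
    c ⊗ subst τ (elim Y)                                            ∎

-- Compiling a formula into a product of two-variable forms.

module Gadgets {c ℓ} (F : Field c ℓ) where
  private module F = Field F
  open Field F using (Carrier; 0#; 1#; -_)
  open Poly F
  open PolynomialRing F
  open HypercubeSums F
  open Gates polynomialRing
  open CommutativeRing polynomialRing hiding (Carrier; 0#; 1#; -_)
  open import Algebra.Properties.Ring F.ring using (-1*x≈-x)
  open import Algebra.Properties.Group F.+-group using (//-rightDividesˡ)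
  open import Relation.Binary.Reasoning.Setoid setoid

  Form : Set c
  Form = Carrier × Carrier × Carrier × ℕ × ℕ

  formProduct : List Form → E
  formProduct L = prod (map formS⁺ L)

  weaken : ℕ → Form → Form
  weaken k (α , β , γ , i , j) = α , β , γ , k ℕ.+ i , k ℕ.+ j

  subst-weaken : ∀ k {σ τ} → (∀ i → τ (k ℕ.+ i) ≡ σ i) → ∀ M →
    subst τ (formProduct (map (weaken k) M)) ≡ subst σ (formProduct M)
  subst-weaken k p [] = ≡.refl
  subst-weaken k p ((α , β , γ , i , j) ∷ M) rewrite p i | p j = ≡.cong (_ ⊗_) (subst-weaken k p M)

  -- Forms carry constants such as `con (- 1#)`, whereas the gate identities use the ring operations
  -- on `con 1#`. These are different expressions with equal coefficients.
  affine₂-cong : ∀ {α β γ A B Γ} x y → con α ≈ A → con β ≈ B → con γ ≈ Γ →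
    ((con α ⊗ x) ⊕ (con β ⊗ y)) ⊕ con γ ≈ affine₂ A B Γ x y
  affine₂-cong x y p q r = +-cong (+-cong (*-congʳ p) (*-congʳ q)) r

  con-neg : ∀ a → con (- a) ≈ -ₚ con a
  con-neg a = trans (con-cong (F.sym (-1*x≈-x a))) (con-* (- 1#) a)

  -- The order of the summands is the numbering: bits of `f` first, then those of `e`, then u, w, v.
  -- Two of the last three control `e` and `f`, so they are summed out last.
  bits : E → ℕ
  bits (var i) = 1
  bits (con a) = 0
  bits (e ⊕ f) = bits f ℕ.+ (bits e ℕ.+ 3)
  bits (e ⊗ f) = bits f ℕ.+ bits e

  controlled : Bool → E → E
  controlled true  e = e
  controlled false e = con 1#

  module _ (h : Carrier) where
    private
      -1# 2# 3h : Carrier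
      -1# = - 1#
      2#  = 1# F.+ 1#
      3h  = (h F.+ h) F.+ h

      con-3h : con 3h ≈ (con h ⊕ con h) ⊕ con h
      con-3h = trans (con-+ _ _) (+-congʳ (con-+ _ _))

    -- The bit s = variable 0 is summed out; t controls the gate of the variable x.
    varForms : (t x : ℕ) → List Form → List Form
    varForms t x M =
      (-1# , -1# , 2# , t , 0) ∷ (3h , 3h , - h , t , 0) ∷ (1# , 1# , 0# , x , 0) ∷ M

    varForms-subst : ∀ σ t x M →
      subst σ (formProduct (varForms t x M)) ≈ varGate (con h) (σ t) (σ 0) (σ x) (subst σ (formProduct M))
    varForms-subst σ t x M =
      *-cong (affine₂-cong _ _ (con-neg 1#) (con-neg 1#) (con-+ 1# 1#))
      (*-cong (affine₂-cong _ _ con-3h con-3h (con-neg h))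
      (*-cong (affine₂-cong _ _ refl refl refl) refl))

    -- The bits u, w, v = variables 0, 1, 2 are summed out; u and w control the two summands.
    sumForms : (t : ℕ) → List Form → List Form
    sumForms t M =
      (-1# , 1# , 1# , 2 , t) ∷ (3h , - 3h , h , 2 , t) ∷ (-1# , 1# , 1# , 0 , 2) ∷
      (-1# , 1# , 1# , 1 , 2) ∷ (-1# , -1# , 2# , 0 , 1) ∷ M

    sumForms-subst : ∀ σ t M →
      subst σ (formProduct (sumForms t M)) ≈ sumGate (con h) (σ t) (σ 2) (σ 1) (σ 0) (subst σ (formProduct M))
    sumForms-subst σ t M =
      *-cong (affine₂-cong _ _ (con-neg 1#) refl refl)
      (*-cong (affine₂-cong _ _ con-3h (trans (con-neg 3h) (-‿cong con-3h)) refl)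
      (*-cong (affine₂-cong _ _ (con-neg 1#) refl refl)
      (*-cong (affine₂-cong _ _ (con-neg 1#) refl refl)
      (*-cong (affine₂-cong _ _ (con-neg 1#) (con-neg 1#) (con-+ 1# 1#)) refl))))

    -- compile e t r M multiplies the product of M by e if the bit t is 1, and by 1 if it is 0, after
    -- its bits are summed out; t, M and r (xᵢ is variable r + i) are numbered without these bits.
    compile : E → (t r : ℕ) → List Form → List Form
    compile (var i) t r M = varForms (suc t) (suc (r ℕ.+ i)) (map (weaken 1) M)
    compile (con a) t r M = (a F.- 1# , 0# , 1# , t , t) ∷ M
    compile (e ⊕ f) t r M =
      compile f (bits e ℕ.+ 1) (bits e ℕ.+ (3 ℕ.+ r))
        (compile e 0 (3 ℕ.+ r) (sumForms (3 ℕ.+ t) (map (weaken 3) M)))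
    compile (e ⊗ f) t r M = compile f (bits e ℕ.+ t) (bits e ℕ.+ r) (compile e t r M)

    module Correctness (h+h≈1 : (h F.+ h) F.≈ 1#) where

      2h-cancel : ∀ e → (con h ⊕ con h) ⊗ e ≈ e
      2h-cancel e = trans (*-congʳ (trans (sym (con-+ h h)) (con-cong h+h≈1))) (*-identityˡ e)

      -- M stands for all forms produced earlier, so gates compose without splitting a product.
      -- Under σ the control must be one of the constants 0 and 1, as the gate identities hold only
      -- there.
      Computes : E → Set (c ⊔ ℓ)
      Computes e = ∀ t r M σ b → σ t ≡ con (bit b) →
        subst σ (elims (bits e) (formProduct (compile e t r M)))
          ≈ controlled b (subst (σ ∘ (r ℕ.+_)) e) ⊗ subst σ (formProduct M)

      -- The control and the variables of `f` lie beyond the k bits still to be summed, so its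
      -- factor does not depend on them and `elims-factor` applies.
      compile-after : ∀ f → Computes f → ∀ k t r M σ b → σ t ≡ con (bit b) →
        subst σ (elims k (elims (bits f) (formProduct (compile f (k ℕ.+ t) (k ℕ.+ r) M))))
          ≈ controlled b (subst (σ ∘ (r ℕ.+_)) f) ⊗ subst σ (elims k (formProduct M))
      compile-after f F-computes k t r M σ b σt = elims-factor k λ τ τ-ext → begin
        subst τ (elims (bits f) (formProduct (compile f (k ℕ.+ t) (k ℕ.+ r) M)))
          ≈⟨ F-computes (k ℕ.+ t) (k ℕ.+ r) M τ b (≡.trans (τ-ext t) σt) ⟩
        controlled b (subst (τ ∘ (k ℕ.+ r ℕ.+_)) f) ⊗ subst τ (formProduct M)
          ≡⟨ ≡.cong (λ g → controlled b g ⊗ _)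
               (subst-cong (λ i → ≡.trans (≡.cong τ (ℕₚ.+-assoc k r i)) (τ-ext (r ℕ.+ i))) f) ⟩
        controlled b (subst (σ ∘ (r ℕ.+_)) f) ⊗ subst τ (formProduct M) ∎

      -- The form (a - 1) t + 1 already interpolates between 1 at t = 0 and a at t = 1, so no bit is
      -- spent.
      con-computes : ∀ a → Computes (con a)
      con-computes a t r M σ b σt = *-congʳ (begin
        ((con (a F.- 1#) ⊗ σ t) ⊕ (con 0# ⊗ σ t)) ⊕ con 1#  ≈⟨ +-congʳ (+-congˡ (zeroˡ (σ t))) ⟩
        ((con (a F.- 1#) ⊗ σ t) ⊕ con 0#) ⊕ con 1#          ≈⟨ +-congʳ (+-identityʳ _) ⟩
        (con (a F.- 1#) ⊗ σ t) ⊕ con 1#                     ≡⟨ ≡.cong (λ x → (con (a F.- 1#) ⊗ x) ⊕ con 1#) σt ⟩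
        (con (a F.- 1#) ⊗ con (bit b)) ⊕ con 1#             ≈⟨ select b ⟩
        controlled b (con a)                                ∎)
        where
        select : ∀ b → (con (a F.- 1#) ⊗ con (bit b)) ⊕ con 1# ≈ controlled b (con a)
        select false = trans (+-congʳ (zeroʳ _)) (+-identityˡ _)
        select true  = begin
          (con (a F.- 1#) ⊗ con 1#) ⊕ con 1#  ≈⟨ +-congʳ (*-identityʳ _) ⟩
          con (a F.- 1#) ⊕ con 1#             ≈⟨ con-+ (a F.- 1#) 1# ⟨
          con ((a F.- 1#) F.+ 1#)             ≈⟨ con-cong (//-rightDividesˡ 1# a) ⟩
          con a                               ∎

      var-computes : ∀ i → Computes (var i)
      var-computes i t r M σ b σt = begin
        subst σ (elim P)
          ≡⟨ subst-elim σ P ⟩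
        subst (con 0# ▹ σ) P ⊕ subst (con 1# ▹ σ) P
          ≈⟨ +-cong (value 0#) (value 1#) ⟩
        gate (σ t) 0# ⊕ gate (σ t) 1#
          ≡⟨ ≡.cong (λ z → gate z 0# ⊕ gate z 1#) σt ⟩
        gate (con (bit b)) 0# ⊕ gate (con (bit b)) 1#
          ≈⟨ select b ⟩
        (con h ⊕ con h) ⊗ (controlled b (σ (r ℕ.+ i)) ⊗ m)
          ≈⟨ 2h-cancel _ ⟩
        controlled b (σ (r ℕ.+ i)) ⊗ m ∎
        where
        P = formProduct (compile (var i) t r M)
        m = subst σ (formProduct M)

        gate : E → Carrier → E
        gate z a = varGate (con h) z (con a) (σ (r ℕ.+ i)) m

        value : ∀ a → subst (con a ▹ σ) P ≈ gate (σ t) a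
        value a = trans (varForms-subst (con a ▹ σ) (suc t) (suc (r ℕ.+ i)) (map (weaken 1) M))
          (reflexive (≡.cong (varGate (con h) (σ t) (con a) (σ (r ℕ.+ i))) (subst-weaken 1 (λ _ → ≡.refl) M)))

        select : ∀ b → gate (con (bit b)) 0# ⊕ gate (con (bit b)) 1#
          ≈ (con h ⊕ con h) ⊗ (controlled b (σ (r ℕ.+ i)) ⊗ m)
        select false = varGate-off (con h) (σ (r ℕ.+ i)) m
        select true  = varGate-on (con h) (σ (r ℕ.+ i)) m

      ⊗-computes : ∀ e f → Computes e → Computes f → Computes (e ⊗ f)
      ⊗-computes e f E-computes F-computes t r M σ b σt = begin
        subst σ (elims (bits f ℕ.+ bits e) P)
          ≡⟨ ≡.cong (subst σ) (elims-+ (bits f) (bits e) P) ⟩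
        subst σ (elims (bits e) (elims (bits f) P))
          ≈⟨ compile-after f F-computes (bits e) t r (compile e t r M) σ b σt ⟩
        controlled b f′ ⊗ subst σ (elims (bits e) (formProduct (compile e t r M)))
          ≈⟨ *-congˡ (E-computes t r M σ b σt) ⟩
        controlled b f′ ⊗ (controlled b e′ ⊗ m)
          ≈⟨ *-assoc _ _ _ ⟨
        (controlled b f′ ⊗ controlled b e′) ⊗ m
          ≈⟨ *-congʳ (merge b) ⟩
        controlled b (e′ ⊗ f′) ⊗ m ∎
        where
        P  = formProduct (compile (e ⊗ f) t r M)
        e′ = subst (σ ∘ (r ℕ.+_)) e
        f′ = subst (σ ∘ (r ℕ.+_)) f
        m  = subst σ (formProduct M)
        merge : ∀ b → controlled b f′ ⊗ controlled b e′ ≈ controlled b (e′ ⊗ f′)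
        merge false = *-identityˡ (con 1#)
        merge true  = *-comm f′ e′

      ⊕-computes : ∀ e f → Computes e → Computes f → Computes (e ⊕ f)
      ⊕-computes e f E-computes F-computes t r M σ b σt = begin
        subst σ (elims (bits f ℕ.+ (bits e ℕ.+ 3)) P)
          ≡⟨ ≡.cong (subst σ) (≡.trans (elims-+ (bits f) (bits e ℕ.+ 3) P) (elims-+ (bits e) 3 (elims (bits f) P))) ⟩
        subst σ (elim (elim (elim Q)))
          ≡⟨ subst-elim³ ⟩
        ((subst (env false false false) Q ⊕ subst (env false false true) Q) ⊕
         (subst (env false true  false) Q ⊕ subst (env false true  true) Q)) ⊕
        ((subst (env true  false false) Q ⊕ subst (env true  false true) Q) ⊕
         (subst (env true  true  false) Q ⊕ subst (env true  true  true) Q))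
          ≈⟨ +-cong (+-cong (+-cong (value false false false) (value false false true))
                            (+-cong (value false true  false) (value false true  true)))
                    (+-cong (+-cong (value true  false false) (value true  false true))
                            (+-cong (value true  true  false) (value true  true  true))) ⟩
        sumGateTotal (con h) (σ t) e′ f′ m
          ≡⟨ ≡.cong (λ z → sumGateTotal (con h) z e′ f′ m) σt ⟩
        sumGateTotal (con h) (con (bit b)) e′ f′ m
          ≈⟨ select b ⟩
        (con h ⊕ con h) ⊗ (controlled b (e′ ⊕ f′) ⊗ m)
          ≈⟨ 2h-cancel _ ⟩
        controlled b (e′ ⊕ f′) ⊗ m ∎
        where
        forms = sumForms (3 ℕ.+ t) (map (weaken 3) M)
        P  = formProduct (compile (e ⊕ f) t r M)
        Q  = elims (bits e) (elims (bits f) P)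
        e′ = subst (σ ∘ (r ℕ.+_)) e
        f′ = subst (σ ∘ (r ℕ.+_)) f
        m  = subst σ (formProduct M)

        env : (v w u : Bool) → ℕ → E
        env v w u = con (bit u) ▹ con (bit w) ▹ con (bit v) ▹ σ

        subst-elim³ : subst σ (elim (elim (elim Q))) ≡
          ((subst (env false false false) Q ⊕ subst (env false false true) Q) ⊕
           (subst (env false true  false) Q ⊕ subst (env false true  true) Q)) ⊕
          ((subst (env true  false false) Q ⊕ subst (env true  false true) Q) ⊕
           (subst (env true  true  false) Q ⊕ subst (env true  true  true) Q))
        subst-elim³ = ≡.trans (subst-elim σ (elim (elim Q))) (≡.cong₂ _⊕_ (inner 0#) (inner 1#))
          where
          inner : ∀ a → subst (con a ▹ σ) (elim (elim Q)) ≡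
            (subst (con 0# ▹ con 0# ▹ con a ▹ σ) Q ⊕ subst (con 1# ▹ con 0# ▹ con a ▹ σ) Q) ⊕
            (subst (con 0# ▹ con 1# ▹ con a ▹ σ) Q ⊕ subst (con 1# ▹ con 1# ▹ con a ▹ σ) Q)
          inner a = ≡.trans (subst-elim _ (elim Q)) (≡.cong₂ _⊕_ (subst-elim _ Q) (subst-elim _ Q))

        selected : (v w u : Bool) → E → E
        selected v w u x =
          controlled w f′ ⊗ (controlled u e′ ⊗ sumGate (con h) (σ t) (con (bit v)) (con (bit w)) (con (bit u)) x)

        value : ∀ v w u → subst (env v w u) Q ≈ selected v w u m
        value v w u = begin
          subst τ Q
            -- The control `bits e + 1` of `f` is variable 1, the bit w, once the bits of `e` are
            -- gone; `e` itself is controlled by u, variable 0.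
            ≈⟨ compile-after f F-computes (bits e) 1 (3 ℕ.+ r) (compile e 0 (3 ℕ.+ r) forms) τ w ≡.refl ⟩
          controlled w f′ ⊗ subst τ (elims (bits e) (formProduct (compile e 0 (3 ℕ.+ r) forms)))
            ≈⟨ *-congˡ (E-computes 0 (3 ℕ.+ r) forms τ u ≡.refl) ⟩
          controlled w f′ ⊗ (controlled u e′ ⊗ subst τ (formProduct forms))
            ≈⟨ *-congˡ (*-congˡ (sumForms-subst τ (3 ℕ.+ t) (map (weaken 3) M))) ⟩
          selected v w u (subst τ (formProduct (map (weaken 3) M)))
            ≡⟨ ≡.cong (selected v w u) (subst-weaken 3 (λ _ → ≡.refl) M) ⟩
          selected v w u m ∎
          where τ = env v w u

        select : ∀ b → sumGateTotal (con h) (con (bit b)) e′ f′ m ≈ (con h ⊕ con h) ⊗ (controlled b (e′ ⊕ f′) ⊗ m)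
        select false = sumGate-off (con h) e′ f′ m
        select true  = sumGate-on (con h) e′ f′ m

      compile-computes : ∀ e → Computes e
      compile-computes (var i) = var-computes i
      compile-computes (con a) = con-computes a
      compile-computes (e ⊕ f) = ⊕-computes e f (compile-computes e) (compile-computes f)
      compile-computes (e ⊗ f) = ⊗-computes e f (compile-computes e) (compile-computes f)

      -- The topmost control bit t is summed out too. The initial form, which is t itself, kills the
      -- term t = 0, which would otherwise contribute 1.
      encode : E → List Form
      encode e = compile e 0 1 ((1# , 0# , 0# , 0 , 0) ∷ [])

      hsum-encode : ∀ e → hsum (bits e ℕ.+ 1) (formProduct (encode e)) ≈ e
      hsum-encode e = begin
        hsum (bits e ℕ.+ 1) P         ≈⟨ hsum-elims (bits e ℕ.+ 1) P ⟩
        elims (bits e ℕ.+ 1) P        ≡⟨ elims-+ (bits e) 1 P ⟩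
        elim (elims (bits e) P)       ≈⟨ +-cong (value false) (value true) ⟩
        (con 1# ⊗ onlyIf 0#) ⊕ (subst (λ i → var i) e ⊗ onlyIf 1#)
                                      ≈⟨ +-cong (trans (*-identityˡ _) (onlyIf-value 0#)) (*-cong (reflexive (subst-var e)) (onlyIf-value 1#)) ⟩
        con 0# ⊕ (e ⊗ con 1#)         ≈⟨ +-identityˡ _ ⟩
        e ⊗ con 1#                    ≈⟨ *-identityʳ e ⟩
        e                             ∎
        where
        P = formProduct (encode e)
        onlyIf : Carrier → E
        onlyIf a = (((con 1# ⊗ con a) ⊕ (con 0# ⊗ con a)) ⊕ con 0#) ⊗ con 1#
        onlyIf-value : ∀ a → onlyIf a ≈ con a
        onlyIf-value a = trans (*-identityʳ _) (trans (+-identityʳ _)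
          (trans (+-cong (*-identityˡ _) (zeroˡ _)) (+-identityʳ _)))
        value : ∀ b → subst (con (bit b) ▹ var) (elims (bits e) P) ≈
          controlled b (subst (λ i → var i) e) ⊗ onlyIf (bit b)
        value b = compile-computes e 0 1 _ (con (bit b) ▹ var) b ≡.refl

-- The compiled product has linear size.

module EncodingBounds {c ℓ} (F : Field c ℓ) (h : Field.Carrier F) where
  open Poly F
  open Gadgets F
  open import Data.Nat.Base using (_+_; _*_)
  open ℕₚ.≤-Reasoning

  bits≤3*size : ∀ e → bits e ≤ 3 * size e
  bits≤3*size (var i) = s≤s z≤n
  bits≤3*size (con a) = z≤n
  bits≤3*size (e ⊕ f) = begin
    bits f + (bits e + 3)         ≤⟨ ℕₚ.+-mono-≤ (bits≤3*size f) (ℕₚ.+-monoˡ-≤ 3 (bits≤3*size e)) ⟩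
    3 * size f + (3 * size e + 3)     ≡⟨ arith (size e) (size f) ⟩
    3 * suc (size e + size f)         ∎
    where
    arith : ∀ a b → 3 * b + (3 * a + 3) ≡ 3 * suc (a + b)
    arith = solve-∀
  bits≤3*size (e ⊗ f) = begin
    bits f + bits e               ≤⟨ ℕₚ.+-mono-≤ (bits≤3*size f) (bits≤3*size e) ⟩
    3 * size f + 3 * size e           ≤⟨ ℕₚ.m≤m+n _ 3 ⟩
    3 * size f + 3 * size e + 3       ≡⟨ arith (size e) (size f) ⟩
    3 * suc (size e + size f)         ∎
    where
    arith : ∀ a b → 3 * b + 3 * a + 3 ≡ 3 * suc (a + b)
    arith = solve-∀

  length-compile : ∀ e t r M → length (compile h e t r M) ≤ 5 * size e + length M
  length-compile (var i) t r M = begin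
    3 + length (map (weaken 1) M)     ≡⟨ ≡.cong (3 +_) (length-map (weaken 1) M) ⟩
    3 + length M                      ≤⟨ ℕₚ.+-monoˡ-≤ (length M) (ℕₚ.m≤m+n 3 2) ⟩
    5 + length M                      ∎
  length-compile (con a) t r M = ℕₚ.+-monoˡ-≤ (length M) (ℕₚ.m≤m+n 1 4)
  length-compile (e ⊕ f) t r M = begin
    length (compile h f _ _ (compile h e 0 (3 + r) gate))   ≤⟨ length-compile f _ _ (compile h e 0 (3 + r) gate) ⟩
    5 * size f + length (compile h e 0 (3 + r) gate)        ≤⟨ ℕₚ.+-monoʳ-≤ (5 * size f) (length-compile e 0 (3 + r) gate) ⟩
    5 * size f + (5 * size e + length gate)                 ≡⟨ ≡.cong (λ l → 5 * size f + (5 * size e + (5 + l))) (length-map (weaken 3) M) ⟩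
    5 * size f + (5 * size e + (5 + length M))              ≡⟨ arith (size e) (size f) (length M) ⟩
    5 * suc (size e + size f) + length M                    ∎
    where
    gate = sumForms h (3 + t) (map (weaken 3) M)
    arith : ∀ a b l → 5 * b + (5 * a + (5 + l)) ≡ 5 * suc (a + b) + l
    arith = solve-∀
  length-compile (e ⊗ f) t r M = begin
    length (compile h f _ _ (compile h e t r M))            ≤⟨ length-compile f _ _ (compile h e t r M) ⟩
    5 * size f + length (compile h e t r M)                 ≤⟨ ℕₚ.+-monoʳ-≤ (5 * size f) (length-compile e t r M) ⟩
    5 * size f + (5 * size e + length M)                    ≤⟨ ℕₚ.m≤m+n _ 5 ⟩
    5 * size f + (5 * size e + length M) + 5                ≡⟨ arith (size e) (size f) (length M) ⟩
    5 * suc (size e + size f) + length M                    ∎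
    where
    arith : ∀ a b l → 5 * b + (5 * a + l) + 5 ≡ 5 * suc (a + b) + l
    arith = solve-∀

  FormBelow : ℕ → Form → Set
  FormBelow B (_ , _ , _ , i , j) = i < B × j < B

  weaken-below : ∀ k {B M} → All (FormBelow B) M → All (FormBelow (k + B)) (map (weaken k) M)
  weaken-below k = Allₚ.map⁺ ∘ All.map λ (i<B , j<B) → ℕₚ.+-monoʳ-< k i<B , ℕₚ.+-monoʳ-< k j<B

  -- B bounds the indices as they are before the bits of `e` are inserted in front, which raises
  -- every older index by `bits e`.
  compile-below : ∀ e {t r s M B} → VarsBelow s e → t < B → r + s ≤ B → All (FormBelow B) M →
    All (FormBelow (bits e + B)) (compile h e t r M)
  compile-below (var i) {r = r} i<s t<B r+s≤B M<B =
    (s≤s t<B , s≤s z≤n) ∷ (s≤s t<B , s≤s z≤n) ∷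
    (s≤s (ℕₚ.<-≤-trans (ℕₚ.+-monoʳ-< r i<s) r+s≤B) , s≤s z≤n) ∷ weaken-below 1 M<B
  compile-below (con a) _ t<B _ M<B = (t<B , t<B) ∷ M<B
  compile-below (e ⊕ f) {t} {r} {s} {M} {B} (e<s , f<s) t<B r+s≤B M<B =
    ≡.subst (λ k → All (FormBelow k) (compile h (e ⊕ f) t r M)) (arith (bits f) (bits e) B)
      (compile-below f f<s (ℕₚ.+-monoʳ-< (bits e) (s≤s (s≤s z≤n)))
        (≡.subst (_≤ bits e + (3 + B)) (≡.sym (ℕₚ.+-assoc (bits e) (3 + r) s)) (ℕₚ.+-monoʳ-≤ (bits e) (ℕₚ.+-monoʳ-≤ 3 r+s≤B)))
        (compile-below e e<s (s≤s z≤n) (ℕₚ.+-monoʳ-≤ 3 r+s≤B) gate-below))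
    where
    arith : ∀ a b d → a + (b + (3 + d)) ≡ a + (b + 3) + d
    arith = solve-∀
    0< : 0 < 3 + B
    0< = s≤s z≤n
    1< : 1 < 3 + B
    1< = s≤s (s≤s z≤n)
    2< : 2 < 3 + B
    2< = s≤s (s≤s (s≤s z≤n))
    t< : 3 + t < 3 + B
    t< = ℕₚ.+-monoʳ-< 3 t<B
    gate-below : All (FormBelow (3 + B)) (sumForms h (3 + t) (map (weaken 3) M))
    gate-below = (2< , t<) ∷ (2< , t<) ∷ (0< , 2<) ∷ (1< , 2<) ∷ (0< , 1<) ∷ weaken-below 3 M<B
  compile-below (e ⊗ f) {t} {r} {s} {M} {B} (e<s , f<s) t<B r+s≤B M<B =
    ≡.subst (λ k → All (FormBelow k) (compile h (e ⊗ f) t r M)) (≡.sym (ℕₚ.+-assoc (bits f) (bits e) B))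
      (compile-below f f<s (ℕₚ.+-monoʳ-< (bits e) t<B)
        (≡.subst (_≤ bits e + B) (≡.sym (ℕₚ.+-assoc (bits e) r s)) (ℕₚ.+-monoʳ-≤ (bits e) r+s≤B))
        (compile-below e e<s t<B r+s≤B M<B))

-- Products of univariate forms do not yield x₀ + x₁.

module Separation {c ℓ} (F : Field c ℓ) where
  private module F = Field F
  open Field F using (Carrier; 0#; 1#)
  open Poly F
  open PolynomialRing F
  open HypercubeSums F
  open CommutativeRing polynomialRing hiding (Carrier; 0#; 1#)
  open import Algebra.Properties.CommutativeSemigroup *-commutativeSemigroup using (interchange; x∙yz≈y∙xz)
  open import Relation.Binary.Reasoning.Setoid setoid

  Univariate : Set c
  Univariate = Carrier × Carrier × ℕ

  univariateProduct : List Univariate → E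
  univariateProduct L = prod (map formS L)

  lower : List Univariate → List Univariate
  lower []                    = []
  lower ((α , β , zero)  ∷ L) = lower L
  lower ((α , β , suc i) ∷ L) = (α , β , i) ∷ lower L

  value₀ : Carrier → List Univariate → Carrier
  value₀ a []                    = 1#
  value₀ a ((α , β , zero)  ∷ L) = (α F.* a F.+ β) F.* value₀ a L
  value₀ a ((α , β , suc i) ∷ L) = value₀ a L

  subst-univariateProduct : ∀ a L →
    subst (con a ▹ var) (univariateProduct L) ≈ con (value₀ a L) ⊗ univariateProduct (lower L)
  subst-univariateProduct a [] = sym (*-identityˡ _)
  subst-univariateProduct a ((α , β , zero) ∷ L) = begin
    ((con α ⊗ con a) ⊕ con β) ⊗ subst (con a ▹ var) (univariateProduct L)
      ≈⟨ *-cong (trans (+-congʳ (sym (con-* α a))) (sym (con-+ _ β))) (subst-univariateProduct a L) ⟩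
    con (α F.* a F.+ β) ⊗ (con (value₀ a L) ⊗ univariateProduct (lower L))
      ≈⟨ *-assoc _ _ _ ⟨
    (con (α F.* a F.+ β) ⊗ con (value₀ a L)) ⊗ univariateProduct (lower L)
      ≈⟨ *-congʳ (con-* _ _) ⟨
    con ((α F.* a F.+ β) F.* value₀ a L) ⊗ univariateProduct (lower L) ∎
  subst-univariateProduct a ((α , β , suc i) ∷ L) = trans (*-congˡ (subst-univariateProduct a L)) (x∙yz≈y∙xz _ _ _)

  -- Setting x₀ turns each form in x₀ into a scalar and only renumbers the others. Both bits thus
  -- leave the same product, and just their scalars are added.
  elim-univariateProduct : ∀ C L → elim (con C ⊗ univariateProduct L) ≈
    con (C F.* (value₀ 0# L F.+ value₀ 1# L)) ⊗ univariateProduct (lower L)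
  elim-univariateProduct C L = begin
    (con C ⊗ subst (con 0# ▹ var) P) ⊕ (con C ⊗ subst (con 1# ▹ var) P)
      ≈⟨ distribˡ _ _ _ ⟨
    con C ⊗ (subst (con 0# ▹ var) P ⊕ subst (con 1# ▹ var) P)
      ≈⟨ *-congˡ (+-cong (subst-univariateProduct 0# L) (subst-univariateProduct 1# L)) ⟩
    con C ⊗ ((con (value₀ 0# L) ⊗ P′) ⊕ (con (value₀ 1# L) ⊗ P′))
      ≈⟨ *-congˡ (distribʳ _ _ _) ⟨
    con C ⊗ ((con (value₀ 0# L) ⊕ con (value₀ 1# L)) ⊗ P′)
      ≈⟨ *-assoc _ _ _ ⟨
    (con C ⊗ (con (value₀ 0# L) ⊕ con (value₀ 1# L))) ⊗ P′
      ≈⟨ *-congʳ (trans (con-* _ _) (*-congˡ (con-+ _ _))) ⟨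
    con (C F.* (value₀ 0# L F.+ value₀ 1# L)) ⊗ P′ ∎
    where
    P  = univariateProduct L
    P′ = univariateProduct (lower L)

  hsum-univariateProduct : ∀ k C L →
    ∃[ C′ ] ∃[ L′ ] hsum k (con C ⊗ univariateProduct L) ≈ con C′ ⊗ univariateProduct L′
  hsum-univariateProduct zero    C L = C , L , hsum-elims 0 _
  hsum-univariateProduct (suc k) C L with hsum-univariateProduct k _ (lower L)
  ... | C′ , L′ , eq = C′ , L′ , trans (hsum-suc k (con C ⊗ univariateProduct L)) (trans (hsum-cong k (elim-univariateProduct C L)) eq)

  at : Bool → Bool → E → E
  at b₀ b₁ = subst (plug (b₀ ∷ b₁ ∷ []))

  Degenerate : E → Set ℓ
  Degenerate e = at false false e ⊗ at true true e ≈ at false true e ⊗ at true false e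

  -- The condition equates two products of values, and substitution is multiplicative, so the
  -- conditions for the factors multiply.
  degenerate-⊗ : ∀ {e f} → Degenerate e → Degenerate f → Degenerate (e ⊗ f)
  degenerate-⊗ p q = trans (interchange _ _ _ _) (trans (*-cong p q) (interchange _ _ _ _))

  -- A form that does not read x₀ gives two equal rows, one that does not read x₁ two equal columns.
  degenerate-formS : ∀ u → Degenerate (formS u)
  degenerate-formS (α , β , 0)           = refl
  degenerate-formS (α , β , 1)           = *-comm _ _
  degenerate-formS (α , β , suc (suc i)) = refl

  degenerate-univariateProduct : ∀ L → Degenerate (univariateProduct L)
  degenerate-univariateProduct []      = refl
  degenerate-univariateProduct (u ∷ L) =
    degenerate-⊗ {formS u} {univariateProduct L} (degenerate-formS u) (degenerate-univariateProduct L)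

  degenerate-resp : ∀ {e f} → e ≈ f → Degenerate e → Degenerate f
  degenerate-resp {e} {f} e≈f p = trans
    (sym (*-cong (at-cong false false) (at-cong true true))) (trans p (*-cong (at-cong false true) (at-cong true false)))
    where
    at-cong : ∀ b₀ b₁ → at b₀ b₁ e ≈ at b₀ b₁ f
    at-cong b₀ b₁ = subst-plug-cong (b₀ ∷ b₁ ∷ []) e≈f

  x₀+x₁ : E
  x₀+x₁ = var 0 ⊕ var 1

  -- The values 0, 1, 1, 2 would give 0 · 2 = 1 · 1, and the constant terms would make 0 equal to 1
  -- in the field.
  x₀+x₁-nondegenerate : ¬ Degenerate x₀+x₁
  x₀+x₁-nondegenerate p = F.1≉0 (F.sym (coeffs-≈ 0≈1 []))
    where
    0≈1 : con 0# ≈ con 1#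
    0≈1 = begin
      con 0#                                              ≈⟨ zeroˡ _ ⟨
      con 0# ⊗ (con 1# ⊕ con 1#)                          ≈⟨ *-congʳ (+-identityʳ _) ⟨
      (con 0# ⊕ con 0#) ⊗ (con 1# ⊕ con 1#)               ≈⟨ p ⟩
      (con 0# ⊕ con 1#) ⊗ (con 1# ⊕ con 0#)               ≈⟨ *-cong (+-identityˡ _) (+-identityʳ _) ⟩
      con 1# ⊗ con 1#                                     ≈⟨ *-identityˡ _ ⟩
      con 1#                                              ∎

  x₀+x₁∈VNP1weak+ : VNP1weak+ (λ _ → x₀+x₁)
  x₀+x₁∈VNP1weak+ = (λ _ → x₀+x₁) ,
    ((λ _ → 2) , (2 , λ n → ℕₚ.m≤m+n 2 (n ^ 2)) , λ n →
      (1# , 1# , 0# , 0 , 1) ∷ [] , s≤s z≤n , (s≤s z≤n , s≤s (s≤s z≤n)) ∷ [] , coeffs-≈ form-eq) ,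
    (λ _ → 0) , (λ _ → 0) , (0 , λ _ → z≤n) , (0 , λ _ → z≤n) ,
    λ n → coeffs-≈ (sym (hsum-elims 0 x₀+x₁))
    where
    form-eq : x₀+x₁ ≈ prod (map formS⁺ ((1# , 1# , 0# , 0 , 1) ∷ []))
    form-eq = sym (trans (*-identityʳ _) (trans (+-identityʳ _) (+-cong (*-identityˡ _) (*-identityˡ _))))

  -- One member of the family decides: the obstruction holds for any number of forms and of summed
  -- bits, so growth rates play no part.
  x₀+x₁∉VNP1weak : ¬ VNP1weak (λ _ → x₀+x₁)
  x₀+x₁∉VNP1weak (g , (_ , _ , g-product) , k , q , _ , _ , f≈) with g-product (q 0)
  ... | L , _ , _ , g≈ with hsum-univariateProduct (k 0) 1# L
  ... | C , L′ , eq = x₀+x₁-nondegenerate (degenerate-resp (sym x₀+x₁≈)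
      (degenerate-⊗ {con C} {univariateProduct L′} refl (degenerate-univariateProduct L′)))
    where
    x₀+x₁≈ : x₀+x₁ ≈ con C ⊗ univariateProduct L′
    x₀+x₁≈ = begin
      x₀+x₁                                            ≈⟨ equalCoeffs (f≈ 0) ⟩
      hsum (k 0) (g (q 0))                             ≈⟨ hsum-cong (k 0) {g (q 0)} {univariateProduct L} (equalCoeffs g≈) ⟩
      hsum (k 0) (univariateProduct L)                 ≈⟨ hsum-cong (k 0) (*-identityˡ (univariateProduct L)) ⟨
      hsum (k 0) (con 1# ⊗ univariateProduct L)        ≈⟨ eq ⟩
      con C ⊗ univariateProduct L′                     ∎

-- The inclusions between the classes.

module Inclusions {c ℓ} (F : Field c ℓ) where
  private module F = Field F
  open Field F using (Carrier; 0#; 1#)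
  open Poly F
  open PolynomialRing F
  open HypercubeSums F
  open CommutativeRing polynomialRing hiding (Carrier; 0#; 1#)
  open import Relation.Binary.Reasoning.Setoid setoid

  N-mono : ∀ {C D} → C ⊆ D → N C ⊆ N D
  N-mono C⊆D f (g , g∈C , rest) = g , C⊆D g g∈C , rest

  VP1weak⊆VP1weak+ : VP1weak ⊆ VP1weak+
  VP1weak⊆VP1weak+ f (p , p-poly , products) = p , p-poly , λ n → go n (products n)
    where
    widen : Carrier × Carrier × ℕ → Carrier × Carrier × Carrier × ℕ × ℕ
    widen (α , β , i) = α , 0# , β , i , i

    widen-formS : ∀ u → formS u ≈ formS⁺ (widen u)
    widen-formS (α , β , i) = +-congʳ (sym (trans (+-congˡ (zeroˡ _)) (+-identityʳ _)))

    widen-prod : ∀ L → prod (map formS L) ≈ prod (map formS⁺ (map widen L))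
    widen-prod []      = refl
    widen-prod (u ∷ L) = *-cong (widen-formS u) (widen-prod L)

    go : ∀ n → _ → _
    go n (L , L≤ , L< , f≈) = map widen L , ≡.subst (_≤ p n) (≡.sym (length-map widen L)) L≤ ,
      Allₚ.map⁺ (All.map (λ i< → i< , i<) L<) , coeffs-≈ (trans (equalCoeffs {f n} f≈) (widen-prod L))

  VP1weak+⊆VPe : VP1weak+ ⊆ VPe
  VP1weak+⊆VPe f (p , p-poly , products) =
    -- A two-variable form has size 9 and its multiplication adds 1; the final 1 is the empty
    -- product.
    (λ n → 10 ℕ.* p n ℕ.+ 1) , polyBounded-affine 10 1 p-poly , λ n → go n (products n)
    where
    size-product : ∀ L → size (prod (map formS⁺ L)) ≡ 10 ℕ.* length L ℕ.+ 1
    size-product []      = ≡.refl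
    size-product (l ∷ L) = ≡.trans (≡.cong (10 ℕ.+_) (size-product L)) (arith (length L))
      where
      arith : ∀ m → 10 ℕ.+ (10 ℕ.* m ℕ.+ 1) ≡ 10 ℕ.* suc m ℕ.+ 1
      arith = solve-∀

    product-below : ∀ {s t} → s ≤ t → ∀ L → All (λ { (_ , _ , _ , i , j) → i < s × j < s }) L →
      VarsBelow t (prod (map formS⁺ L))
    product-below s≤t []      []                  = tt
    product-below s≤t (l ∷ L) ((i<s , j<s) ∷ L<s) =
      (((tt , ℕₚ.<-≤-trans i<s s≤t) , (tt , ℕₚ.<-≤-trans j<s s≤t)) , tt) , product-below s≤t L L<s

    go : ∀ n → _ → _
    go n (L , L≤ , L< , f≈) = prod (map formS⁺ L) ,
      ℕₚ.≤-trans (ℕₚ.≤-reflexive (size-product L)) (ℕₚ.+-monoˡ-≤ 1 (ℕₚ.*-monoʳ-≤ 10 L≤)) ,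
      product-below (ℕₚ.m≤n⇒m≤n+o 1 (ℕₚ.m≤m+n (p n) (9 ℕ.* p n))) L L< , f≈

  module _ (h : Carrier) (h+h≈1 : (h F.+ h) F.≈ 1#) where
    open Gadgets F
    open Correctness h h+h≈1
    open EncodingBounds F h

    -- `encode` treats the p n bits already summed over as ordinary variables and puts its own bits
    -- in front of them, so `hsum-+` merges both sums into one.
    VNP⊆VNP1weak+ : VNP ⊆ VNP1weak+
    VNP⊆VNP1weak+ f (g , (s , s-poly , formulas) , p , q , p-poly , q-poly , f≈) =
      (λ n → formProduct (encode (e n))) , (bound , bound-poly , λ n → encode (e n) , length-encode n , encode-below n , λ _ → F.refl) ,
      (λ n → bits (e n) ℕ.+ 1 ℕ.+ p n) , id , bits-poly , (1 , id-bound) , λ n → coeffs-≈ (f-hsum n)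
      where
      s′ : ℕ → ℕ
      s′ = s ∘ q

      e : ℕ → E
      e n = proj₁ (formulas (q n))

      e-size : ∀ n → size (e n) ≤ s′ n
      e-size n = proj₁ (proj₂ (formulas (q n)))

      g≈e : ∀ n → g (q n) ≈ e n
      g≈e n = equalCoeffs (proj₂ (proj₂ (proj₂ (formulas (q n)))))

      bound : ℕ → ℕ
      -- This bounds the number of forms, five per node and the initial one, and also the variables:
      -- three bits per node, the top control bit and at most `s′ n` original variables.
      bound n = 5 ℕ.* s′ n ℕ.+ 1

      s′-poly : PolyBounded s′
      s′-poly = dominated⇒polyBounded (dominated-∘ (polyBounded⇒dominated s-poly) (polyBounded⇒dominated q-poly))

      bound-poly : PolyBounded bound
      bound-poly = polyBounded-affine 5 1 s′-poly

      id-bound : ∀ n → n ≤ 1 ℕ.+ n ^ 1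
      id-bound n = ℕₚ.≤-trans (ℕₚ.≤-reflexive (≡.sym (ℕₚ.*-identityʳ n))) (ℕₚ.n≤1+n _)

      bits-poly : PolyBounded (λ n → bits (e n) ℕ.+ 1 ℕ.+ p n)
      bits-poly = dominated⇒polyBounded (dominated-mono
        (λ n → ℕₚ.+-monoˡ-≤ (p n) (ℕₚ.+-monoˡ-≤ 1 (ℕₚ.≤-trans (bits≤3*size (e n)) (ℕₚ.*-monoʳ-≤ 3 (e-size n)))))
        (dominated-+ (polyBounded⇒dominated (polyBounded-affine 3 1 s′-poly)) (polyBounded⇒dominated p-poly)))

      length-encode : ∀ n → length (encode (e n)) ≤ bound n
      length-encode n = ℕₚ.≤-trans (length-compile (e n) 0 1 _) (ℕₚ.+-monoˡ-≤ 1 (ℕₚ.*-monoʳ-≤ 5 (e-size n)))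

      encode-below : ∀ n → All (λ { (_ , _ , _ , i , j) → i < bound n × j < bound n }) (encode (e n))
      encode-below n = All.map (λ (i< , j<) → ℕₚ.<-≤-trans i< below≤ , ℕₚ.<-≤-trans j< below≤)
        (compile-below (e n) (proj₁ (proj₂ (proj₂ (formulas (q n))))) (s≤s z≤n) ℕₚ.≤-refl
          ((s≤s z≤n , s≤s z≤n) ∷ []))
        where
        arith : ∀ a → 3 ℕ.* a ℕ.+ (1 ℕ.+ a) ℕ.+ a ≡ 5 ℕ.* a ℕ.+ 1
        arith = solve-∀
        below≤ : bits (e n) ℕ.+ (1 ℕ.+ s′ n) ≤ bound n
        below≤ = ℕₚ.≤-trans (ℕₚ.+-monoˡ-≤ (1 ℕ.+ s′ n) (ℕₚ.≤-trans (bits≤3*size (e n)) (ℕₚ.*-monoʳ-≤ 3 (e-size n))))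
          (ℕₚ.≤-trans (ℕₚ.m≤m+n _ (s′ n)) (ℕₚ.≤-reflexive (arith (s′ n))))

      f-hsum : ∀ n → f n ≈ hsum (bits (e n) ℕ.+ 1 ℕ.+ p n) (formProduct (encode (e n)))
      f-hsum n = begin
        f n                                                            ≈⟨ equalCoeffs (f≈ n) ⟩
        hsum (p n) (g (q n))                                           ≈⟨ hsum-cong (p n) (g≈e n) ⟩
        hsum (p n) (e n)                                               ≈⟨ hsum-cong (p n) (hsum-encode (e n)) ⟨
        hsum (p n) (hsum (bits (e n) ℕ.+ 1) (formProduct (encode (e n))))
                                                                       ≈⟨ hsum-+ (bits (e n) ℕ.+ 1) (p n) (formProduct (encode (e n))) ⟨
        hsum (bits (e n) ℕ.+ 1 ℕ.+ p n) (formProduct (encode (e n))) ∎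

theorem6p2 : ∀ {c ℓ} (F : Field c ℓ) →
    ¬ (Field._≈_ F (Field._+_ F (Field.1# F) (Field.1# F)) (Field.0# F)) →
    Poly._⊆_ F (Poly.VNP1weak F) (Poly.VNP1weak+ F) ×
    ¬ Poly._⊆_ F (Poly.VNP1weak+ F) (Poly.VNP1weak F) ×
    Poly._⊆_ F (Poly.VNP1weak+ F) (Poly.VNP F) ×
    Poly._⊆_ F (Poly.VNP F) (Poly.VNP1weak+ F)
theorem6p2 F 2≉0 =
  N-mono VP1weak⊆VP1weak+ ,
  (λ VNP1weak+⊆VNP1weak → x₀+x₁∉VNP1weak (VNP1weak+⊆VNP1weak (λ _ → x₀+x₁) x₀+x₁∈VNP1weak+)) ,
  N-mono VP1weak+⊆VPe ,
  VNP⊆VNP1weak+ (proj₁ half) h+h≈1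
  where
  open Field F
  open Separation F
  open Inclusions F
  half : ∃[ h ] (1# + 1#) * h ≈ 1#
  half = inverse (1# + 1#) 2≉0
  h+h≈1 : proj₁ half + proj₁ half ≈ 1#
  h+h≈1 = trans (sym (trans (distribʳ _ _ _) (+-cong (*-identityˡ _) (*-identityˡ _)))) (proj₂ half)
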